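{- Let $\Sigma$ be a finite alphabet, $\lambda\in[0,1)$, and let $L=\mathcal{L}^{>\lambda}(\mathcal{A}|\mathrm{D})$ for some quantum automaton $\mathcal{A}$ over $\Sigma$. Then: (1) For any $w\in\Sigma^+$, $u\in\Sigma^*$ and $v\in\Sigma^\omega$, if $uv\in L$ then there are infinitely many positive integers $k$ such that $uw^kv\in L$. (2) For any $v\in L$, there are infinitely many finite prefixes $v_n$ of $v$ such that $v_nw^\omega\in L$ for all $w\in\Sigma^+$. (3) For any positive integer $n$, each $w\in L$ can be written as $w=xyz$ with $x,y\in\Sigma^*$, $z\in\Sigma^\omega$, such that $|x|\ge n$, $|y|\ge1$, and $xy^kz\in L$ for all $k\in\mathbb{N}$.
   Context: A quantum automaton is a tuple $\mathcal{A}=(\mathcal{H},|s_0\rangle,\Sigma,\{U_\sigma:\sigma\in\Sigma\},F)$ where $\mathcal{H}$ is a finite-dimensional complex Hilbert space, $|s_0\rangle$ a unit vector, $\Sigma$ a finite alphabet, each $U_\sigma$ unitary, and $F$ a subspace. For $w=\sigma_1\sigma_2\cdots\in\Sigma^\omega$, a unit vector $|\psi\rangle\in F$ and checkpoints $0\le n_1<n_2<\cdots$, the disturbing run is $|s_0\rangle$ (initial state) and for $n\ge1$: $|s_n\rangle=U_{\sigma_n}|\psi\rangle$ if $n-1=n_i$ for some $i$, else $|s_n\rangle=U_{\sigma_n}|s_{n-1}\rangle$. Then $f^{\mathrm{D}}_{\mathcal{A}}(w)=\sup_{|\psi\rangle}\sup_{\{n_i\}}\inf_{i\ge1}|\langle\psi|s_{n_i}\rangle|^2$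 (sup over unit $|\psi\rangle\in F$ and strictly increasing checkpoint sequences), and $\mathcal{L}^{>\lambda}(\mathcal{A}|\mathrm{D})=\{w\in\Sigma^\omega: f^{\mathrm{D}}_{\mathcal{A}}(w)>\lambda\}$. $|x|$ is the length of a finite word $x$. -}

module Defs where

open import Algebra.Bundles using (CommutativeRing)
open import Algebra.Definitions.RawMonoid using (sum)
open import Algebra.Module.Bundles using (LeftModule)
open import Algebra.Module.Morphism.Structures using (module LeftModuleMorphisms)
open import Axiom.ExcludedMiddle using (ExcludedMiddle)
open import Data.Fin.Base using (Fin)
open import Data.List.Base using (List; []; _∷_; length; lookup; concat; replicate)
open import Data.List.NonEmpty.Base using (List⁺; _∷_)
open import Data.Nat.Base as ℕ using (ℕ; zero; suc)
open import Data.Nat.DivMod using (_mod_)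
open import Data.Product.Base using (Σ; ∃; _×_; _,_)
open import Data.Vec.Functional using (Vector)
open import Function.Bundles using (_↔_)
open import Level using (0ℓ)
open import Relation.Binary.Core using (Rel)
open import Relation.Binary.PropositionalEquality.Core using (_≡_)
open import Relation.Binary.Structures using (IsTotalOrder)
open import Relation.Nullary.Decidable.Core using (yes; no)
open import Relation.Nullary.Negation.Core using (¬_)
open import Relation.Unary using (Pred; _∈_)
import Relation.Binary.Construct.NonStrictToStrict as ToStrict

Finite : Set → Set
Finite A = ∃ λ n → A ↔ Fin n

InfinitelyMany : Pred ℕ 0ℓ → Set
InfinitelyMany P = ∀ N → ∃ λ n → N ℕ.< n × P n

-- Infinite words.  The letter σₙ (n ≥ 1) of w = σ₁σ₂⋯ is w (n - 1).

infix 9 _^ω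

_^ω : Set → Set
A ^ω = ℕ → A

module _ {A : Set} where

  infixr 5 _++ω_
  infixr 8 _^_

  _++ω_ : List A → A ^ω → A ^ω
  ([]      ++ω v) n       = v n
  ((a ∷ u) ++ω v) zero    = a
  ((a ∷ u) ++ω v) (suc n) = (u ++ω v) n

  _^_ : List A → ℕ → List A
  w ^ k = concat (replicate k w)

  repeat : List⁺ A → A ^ω
  repeat (a ∷ w) n = lookup (a ∷ w) (n mod length (a ∷ w))

module Bounds {A : Set} (_≤_ : Rel A 0ℓ) where

  UpperBound LowerBound IsSup IsInf : Pred A 0ℓ → Pred A 0ℓ
  UpperBound P b = ∀ x → x ∈ P → x ≤ b
  LowerBound P b = ∀ x → x ∈ P → b ≤ x
  IsSup P s = UpperBound P s × (∀ b → UpperBound P b → s ≤ b)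
  IsInf P s = LowerBound P s × (∀ b → LowerBound P b → b ≤ s)

-- The standard library has no real numbers.  The axioms below determine them
-- up to isomorphism (given excluded middle); equality is a setoid equality,
-- so that e.g. Cauchy sequences are admitted as a carrier.

record CompleteOrderedField : Set₁ where
  infix 4 _≤_
  field
    commutativeRing : CommutativeRing 0ℓ 0ℓ

  open CommutativeRing commutativeRing public

  field
    0≉1          : ¬ 0# ≈ 1#
    inverse      : ∀ x → ¬ x ≈ 0# → ∃ λ y → x * y ≈ 1#
    _≤_          : Rel Carrier 0ℓ
    isTotalOrder : IsTotalOrder _≈_ _≤_
    +-monoʳ-≤    : ∀ x {y z} → y ≤ z → x + y ≤ x + z
    *-nonNeg     : ∀ {x y} → 0# ≤ x → 0# ≤ y → 0# ≤ x * y

  open Bounds _≤_ public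

  field
    complete : ∀ P → ∃ P → ∃ (UpperBound P) → ∃ (IsSup P)

  open ToStrict _≈_ _≤_ public using (_<_)

module Suprema (em : ExcludedMiddle 0ℓ) (ℝ : CompleteOrderedField) where
  open CompleteOrderedField ℝ

  range : {I : Set} → (I → Carrier) → Pred Carrier 0ℓ
  range f x = ∃ λ i → x ≈ f i

  -- ⨆ f and ⨅ f have the value 0# when the bound does not exist.  For the
  -- [0,1]-valued families used below this happens only for I empty, where
  -- ⨆ f = 0# is the supremum of ∅ in [0,1].

  ⨆ : {I : Set} → (I → Carrier) → Carrier
  ⨆ f with em {∃ (IsSup (range f))}
  ... | yes (s , _) = s
  ... | no  _       = 0#

  ⨅ : {I : Set} → (I → Carrier) → Carrier
  ⨅ f with em {∃ (IsInf (range f))}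
  ... | yes (s , _) = s
  ... | no  _       = 0#

module ComplexNumbers (ℝ : CompleteOrderedField) where
  private module ℝ = CompleteOrderedField ℝ
  open ℝ using (_+_; _*_; -_; _-_; 0#; 1#)

  infix 5 _+i_

  record ℂ : Set where
    constructor _+i_
    field
      re im : ℝ.Carrier

  open ℂ public

  conj : ℂ → ℂ
  conj (a +i b) = a +i (- b)

  ∣_∣² : ℂ → ℝ.Carrier
  ∣ a +i b ∣² = a * a + b * b

  private
    open import Algebra.Properties.Ring ℝ.ring using (-‿distribˡ-*; -‿distribʳ-*)
    open import Algebra.Solver.Ring.NaturalCoefficients.Default ℝ.commutativeSemiring
      using (solve; _:=_; _:+_; _:*_)
    open import Relation.Binary.Reasoning.Setoid ℝ.setoid

    _≈ᶜ_ : Rel ℂ 0ℓ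
    (a +i b) ≈ᶜ (c +i d) = (a ℝ.≈ c) × (b ℝ.≈ d)

    _+ᶜ_ _*ᶜ_ : ℂ → ℂ → ℂ
    (a +i b) +ᶜ (c +i d) = (a + c) +i (b + d)
    (a +i b) *ᶜ (c +i d) = (a * c - b * d) +i (a * d + b * c)

    -ᶜ_ : ℂ → ℂ
    -ᶜ (a +i b) = (- a) +i (- b)

    x-0≈x : ∀ {x y} → y ℝ.≈ 0# → (x - y) ℝ.≈ x
    x-0≈x {x} {y} y≈0 =
      ℝ.trans (ℝ.sym (ℝ.+-identityʳ _))
      (ℝ.trans (ℝ.+-congˡ (ℝ.sym y≈0))
      (ℝ.trans (ℝ.+-assoc x (- y) y)
      (ℝ.trans (ℝ.+-congˡ (ℝ.-‿inverseˡ y)) (ℝ.+-identityʳ x))))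

    x+0≈x : ∀ {x y} → y ℝ.≈ 0# → (x + y) ℝ.≈ x
    x+0≈x y≈0 = ℝ.trans (ℝ.+-congˡ y≈0) (ℝ.+-identityʳ _)

    *ᶜ-comm : ∀ x y → (x *ᶜ y) ≈ᶜ (y *ᶜ x)
    *ᶜ-comm (a +i b) (c +i d) =
        ℝ.+-cong (ℝ.*-comm a c) (ℝ.-‿cong (ℝ.*-comm b d))
      , ℝ.trans (ℝ.+-cong (ℝ.*-comm a d) (ℝ.*-comm b c)) (ℝ.+-comm _ _)

    *ᶜ-assoc : ∀ x y z → ((x *ᶜ y) *ᶜ z) ≈ᶜ (x *ᶜ (y *ᶜ z))
    *ᶜ-assoc (a +i b) (c +i d) (e +i f) =
        (begin
          (a * c - b * d) * e - (a * d + b * c) * f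
            ≈⟨ ℝ.+-cong (ℝ.*-congʳ (ℝ.+-congˡ (-‿distribˡ-* b d))) (-‿distribʳ-* _ f) ⟩
          (a * c + (- b) * d) * e + (a * d + b * c) * (- f)
            ≈⟨ solve 8 (λ a b c d e f b′ f′ →
                 (a :* c :+ b′ :* d) :* e :+ (a :* d :+ b :* c) :* f′
                 := a :* (c :* e :+ d :* f′) :+ (b :* f′ :* c :+ b′ :* d :* e))
                 ℝ.refl a b c d e f (- b) (- f) ⟩
          a * (c * e + d * (- f)) + (b * (- f) * c + (- b) * d * e)
            ≈⟨ ℝ.+-cong (ℝ.*-congˡ (ℝ.+-congˡ (-‿distribʳ-* d f)))
                        (ℝ.+-congʳ (ℝ.*-congʳ (ℝ.trans (ℝ.sym (-‿distribˡ-* b f)) (-‿distribʳ-* b f)))) ⟨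
          a * (c * e - d * f) + ((- b) * f * c + (- b) * d * e)
            ≈⟨ ℝ.+-congˡ (solve 5 (λ b′ c d e f →
                 b′ :* f :* c :+ b′ :* d :* e := b′ :* (c :* f :+ d :* e))
                 ℝ.refl (- b) c d e f) ⟩
          a * (c * e - d * f) + (- b) * (c * f + d * e)
            ≈⟨ ℝ.+-congˡ (-‿distribˡ-* b _) ⟨
          a * (c * e - d * f) - b * (c * f + d * e) ∎)
      , (begin
          (a * c - b * d) * f + (a * d + b * c) * e
            ≈⟨ ℝ.+-congʳ (ℝ.*-congʳ (ℝ.+-congˡ (-‿distribʳ-* b d))) ⟩
          (a * c + b * (- d)) * f + (a * d + b * c) * e
            ≈⟨ solve 7 (λ a b c d e f d′ →
                 (a :* c :+ b :* d′) :* f :+ (a :* d :+ b :* c) :* e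
                 := a :* (c :* f :+ d :* e) :+ b :* (c :* e :+ d′ :* f))
                 ℝ.refl a b c d e f (- d) ⟩
          a * (c * f + d * e) + b * (c * e + (- d) * f)
            ≈⟨ ℝ.+-congˡ (ℝ.*-congˡ (ℝ.+-congˡ (-‿distribˡ-* d f))) ⟨
          a * (c * f + d * e) + b * (c * e - d * f) ∎)

    *ᶜ-identityˡ : ∀ x → ((1# +i 0#) *ᶜ x) ≈ᶜ x
    *ᶜ-identityˡ (a +i b) =
        ℝ.trans (x-0≈x (ℝ.zeroˡ b)) (ℝ.*-identityˡ a)
      , ℝ.trans (x+0≈x (ℝ.zeroˡ a)) (ℝ.*-identityˡ b)

    *ᶜ-distribˡ : ∀ x y z → (x *ᶜ (y +ᶜ z)) ≈ᶜ ((x *ᶜ y) +ᶜ (x *ᶜ z))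
    *ᶜ-distribˡ (a +i b) (c +i d) (e +i f) =
        (begin
          a * (c + e) - b * (d + f)
            ≈⟨ ℝ.+-congˡ (-‿distribˡ-* b _) ⟩
          a * (c + e) + (- b) * (d + f)
            ≈⟨ solve 6 (λ a b′ c d e f →
                 a :* (c :+ e) :+ b′ :* (d :+ f)
                 := (a :* c :+ b′ :* d) :+ (a :* e :+ b′ :* f))
                 ℝ.refl a (- b) c d e f ⟩
          (a * c + (- b) * d) + (a * e + (- b) * f)
            ≈⟨ ℝ.+-cong (ℝ.+-congˡ (-‿distribˡ-* b d)) (ℝ.+-congˡ (-‿distribˡ-* b f)) ⟨
          (a * c - b * d) + (a * e - b * f) ∎)
      , solve 6 (λ a b c d e f →
          a :* (d :+ f) :+ b :* (c :+ e)
          := (a :* d :+ b :* c) :+ (a :* f :+ b :* e)) ℝ.refl a b c d e f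

    ≈ᶜ-trans : ∀ {x y z} → x ≈ᶜ y → y ≈ᶜ z → x ≈ᶜ z
    ≈ᶜ-trans (p , q) (r , s) = ℝ.trans p r , ℝ.trans q s

    +ᶜ-cong : ∀ {x y u v} → x ≈ᶜ y → u ≈ᶜ v → (x +ᶜ u) ≈ᶜ (y +ᶜ v)
    +ᶜ-cong (p , q) (r , s) = ℝ.+-cong p r , ℝ.+-cong q s

  ℂ-commutativeRing : CommutativeRing 0ℓ 0ℓ
  ℂ-commutativeRing = record
    { Carrier = ℂ
    ; _≈_     = _≈ᶜ_
    ; _+_     = _+ᶜ_
    ; _*_     = _*ᶜ_
    ; -_      = -ᶜ_
    ; 0#      = 0# +i 0#
    ; 1#      = 1# +i 0#
    ; isCommutativeRing = record
      { isRing = record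
        { +-isAbelianGroup = record
          { isGroup = record
            { isMonoid = record
              { isSemigroup = record
                { isMagma = record
                  { isEquivalence = record
                    { refl  = ℝ.refl , ℝ.refl
                    ; sym   = λ (p , q) → ℝ.sym p , ℝ.sym q
                    ; trans = ≈ᶜ-trans
                    }
                  ; ∙-cong = +ᶜ-cong
                  }
                ; assoc = λ _ _ _ → ℝ.+-assoc _ _ _ , ℝ.+-assoc _ _ _
                }
              ; identity = (λ _ → ℝ.+-identityˡ _ , ℝ.+-identityˡ _)
                         , (λ _ → ℝ.+-identityʳ _ , ℝ.+-identityʳ _)
              }
            ; inverse = (λ _ → ℝ.-‿inverseˡ _ , ℝ.-‿inverseˡ _)
                      , (λ _ → ℝ.-‿inverseʳ _ , ℝ.-‿inverseʳ _)
            ; ⁻¹-cong = λ (p , q) → ℝ.-‿cong p , ℝ.-‿cong q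
            }
          ; comm = λ _ _ → ℝ.+-comm _ _ , ℝ.+-comm _ _
          }
        ; *-cong = λ (p , q) (r , s) →
              ℝ.+-cong (ℝ.*-cong p r) (ℝ.-‿cong (ℝ.*-cong q s))
            , ℝ.+-cong (ℝ.*-cong p s) (ℝ.*-cong q r)
        ; *-assoc = *ᶜ-assoc
        ; *-identity = *ᶜ-identityˡ
                     , (λ x → ≈ᶜ-trans (*ᶜ-comm x _) (*ᶜ-identityˡ x))
        ; distrib = *ᶜ-distribˡ
                  , (λ x y z → ≈ᶜ-trans (*ᶜ-comm (y +ᶜ z) x)
                      (≈ᶜ-trans (*ᶜ-distribˡ x y z)
                        (+ᶜ-cong (*ᶜ-comm x y) (*ᶜ-comm x z))))
        }
      ; *-comm = *ᶜ-comm
      }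
    }

module HilbertSpaces (ℝ : CompleteOrderedField) where
  private module ℝ = CompleteOrderedField ℝ
  open ComplexNumbers ℝ public
  module ℂ-Ring = CommutativeRing ℂ-commutativeRing
  open ℂ-Ring using (_≈_; _+_; 0#; 1#) renaming (_*_ to _·_)

  -- A finite-dimensional complex inner product space is automatically
  -- complete.  ⟨_∣_⟩ is linear in its second argument.

  record FiniteDimensionalHilbertSpace : Set₁ where
    field
      leftModule : LeftModule ℂ-Ring.ring 0ℓ 0ℓ

    open LeftModule leftModule public

    field
      ⟨_∣_⟩             : Carrierᴹ → Carrierᴹ → ℂ
      ⟨∣⟩-cong          : ∀ {x x′ y y′} → x ≈ᴹ x′ → y ≈ᴹ y′ → ⟨ x ∣ y ⟩ ≈ ⟨ x′ ∣ y′ ⟩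
      ⟨∣⟩-conj-sym      : ∀ x y → ⟨ x ∣ y ⟩ ≈ conj ⟨ y ∣ x ⟩
      ⟨∣⟩-+ʳ            : ∀ x y z → ⟨ x ∣ y +ᴹ z ⟩ ≈ ⟨ x ∣ y ⟩ + ⟨ x ∣ z ⟩
      ⟨∣⟩-*ʳ            : ∀ x c y → ⟨ x ∣ c *ₗ y ⟩ ≈ c · ⟨ x ∣ y ⟩
      ⟨∣⟩-nonNegative   : ∀ x → ℝ.0# ℝ.≤ re ⟨ x ∣ x ⟩
      ⟨∣⟩-definite      : ∀ x → ⟨ x ∣ x ⟩ ≈ 0# → x ≈ᴹ 0ᴹ
      finiteDimensional : ∃ λ d → Σ (Vector Carrierᴹ d) λ e →
                            ∀ x → Σ (Vector ℂ d) λ c →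
                              x ≈ᴹ sum +ᴹ-rawMonoid (λ i → c i *ₗ e i)

    IsUnit : Pred Carrierᴹ 0ℓ
    IsUnit x = ⟨ x ∣ x ⟩ ≈ 1#

  module _ (H : FiniteDimensionalHilbertSpace) where
    open FiniteDimensionalHilbertSpace H
    open LeftModuleMorphisms rawLeftModule rawLeftModule using (IsLeftModuleHomomorphism)

    record UnitaryOperator : Set where
      field
        ⟦_⟧      : Carrierᴹ → Carrierᴹ
        isLinear : IsLeftModuleHomomorphism ⟦_⟧
        ⟦_⟧†     : Carrierᴹ → Carrierᴹ
        adjoint  : ∀ x y → ⟨ ⟦ x ⟧† ∣ y ⟩ ≈ ⟨ x ∣ ⟦ y ⟧ ⟩
        U†U≈I    : ∀ x → ⟦ ⟦ x ⟧ ⟧† ≈ᴹ x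
        UU†≈I    : ∀ x → ⟦ ⟦ x ⟧† ⟧ ≈ᴹ x

    record Subspace : Set₁ where
      field
        member    : Pred Carrierᴹ 0ℓ
        resp      : ∀ {x y} → x ≈ᴹ y → x ∈ member → y ∈ member
        0ᴹ-closed : 0ᴹ ∈ member
        +ᴹ-closed : ∀ {x y} → x ∈ member → y ∈ member → x +ᴹ y ∈ member
        *ₗ-closed : ∀ c {x} → x ∈ member → c *ₗ x ∈ member

module QuantumAutomata (em : ExcludedMiddle 0ℓ) (ℝ : CompleteOrderedField) where
  private module ℝ = CompleteOrderedField ℝ
  open Suprema em ℝ public
  open HilbertSpaces ℝ public

  record QuantumAutomaton (A : Set) : Set₁ where
    field
      H : FiniteDimensionalHilbertSpace

    open FiniteDimensionalHilbertSpace H public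

    field
      s₀      : Carrierᴹ
      s₀-unit : IsUnit s₀
      U       : A → UnitaryOperator H
      F       : Subspace H

  -- The checkpoint n_i (i ≥ 1) is at (i - 1).

  record Checkpoints : Set where
    field
      at         : ℕ → ℕ
      increasing : ∀ {i j} → i ℕ.< j → at i ℕ.< at j

  module _ {A : Set} (𝒜 : QuantumAutomaton A) where
    open QuantumAutomaton 𝒜
    open UnitaryOperator using (⟦_⟧)

    UnitVectorInF : Set
    UnitVectorInF = ∃ λ ψ → ψ ∈ Subspace.member F × IsUnit ψ

    disturbingRun : A ^ω → Carrierᴹ → Checkpoints → ℕ → Carrierᴹ
    disturbingRun w ψ c zero = s₀
    disturbingRun w ψ c (suc n) with em {∃ λ i → n ≡ Checkpoints.at c i}
    ... | yes _ = ⟦ U (w n) ⟧ ψ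
    ... | no  _ = ⟦ U (w n) ⟧ (disturbingRun w ψ c n)

    fᴰ : A ^ω → ℝ.Carrier
    fᴰ w =
      ⨆ λ ((ψ , _) : UnitVectorInF) →
      ⨆ λ (c : Checkpoints) →
      ⨅ λ (i : ℕ) → ∣ ⟨ ψ ∣ disturbingRun w ψ c (Checkpoints.at c i) ⟩ ∣²

  𝓛ᴰ> : {A : Set} → ℝ.Carrier → QuantumAutomaton A → Pred (A ^ω) 0ℓ
  𝓛ᴰ> λ₀ 𝒜 w = λ₀ ℝ.< fᴰ 𝒜 w

{-# OPTIONS --safe #-}

-- Membership of w in the language means that w can be cut into segments p₀ p₁ p₂ ⋯ (nonempty after the
-- first) such that, for some unit ψ ∈ F and some δ > λ₀, the state T(p₀)s₀ and all the states T(pᵢ)ψ have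
-- fidelity at least δ with ψ.  So segments can be repeated or dropped freely, which is (3).  For (1) and (2),
-- powers of a unitary on a finite-dimensional space are recurrent: a bounded orbit visits a small cell of a
-- finite cover twice, so T(wᵏ)x is arbitrarily close to x for infinitely many k.  Inserting such a wᵏ inside
-- a segment costs arbitrarily little fidelity, and T(wᵏ)ψ has fidelity almost 1 > λ₀ with ψ, so that w^ω can
-- be cut into segments wᵏ.

module Submission where

open import Algebra.Bundles using (CommutativeRing; RawRing)
open import Algebra.Definitions.RawMonoid using (sum)
open import Algebra.Solver.Ring.AlmostCommutativeRing using (fromCommutativeRing; _-Raw-AlmostCommutative⟶_)
open import Axiom.ExcludedMiddle using (ExcludedMiddle)
open import Data.Empty using (⊥-elim)
open import Data.Fin.Base using (Fin; zero; suc; toℕ; fromℕ<; combine; remQuot)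
open import Data.Fin.Properties using (pigeonhole; remQuot-combine; fromℕ<-cong)
open import Data.List.Base using (List; []; _∷_; _++_; length; lookup; concat; applyUpTo)
open import Data.List.NonEmpty.Base using (List⁺; _∷_; toList)
open import Data.List.Properties using (++-assoc; ++-identityʳ; length-++; length-applyUpTo)
open import Data.List.Relation.Unary.All as All using (All; []; _∷_)
open import Data.List.Relation.Unary.All.Properties using (replicate⁺)
open import Data.Maybe.Base using (Maybe; just; nothing)
open import Data.Nat.Base as ℕ using (ℕ; zero; suc; z≤n; s≤s)
open import Data.Nat.DivMod using (_%_; m%n<n; m<n⇒m%n≡m; [m+n]%n≡m%n)
import Data.Nat.Properties as ℕ
open import Data.Product.Base using (∃; _×_; _,_; proj₁; proj₂)
open import Data.Sum.Base using (_⊎_; inj₁; inj₂)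
open import Data.Unit.Base using (⊤; tt)
open import Data.Vec.Functional using (Vector)
open import Function.Base using (_∘_)
open import Level using (0ℓ)
open import Relation.Binary.Bundles using (TotalOrder)
open import Relation.Binary.Core using (Rel)
open import Relation.Binary.PropositionalEquality as ≡ using (_≡_; _≗_)
open import Relation.Binary.Structures using (IsTotalOrder)
open import Relation.Nullary.Decidable.Core using (yes; no)
open import Relation.Nullary.Negation.Core using (¬_)
open import Relation.Unary using (Pred; _∈_; _⊆_)
import Algebra.Properties.Semiring.Mult as SemiringMult
import Relation.Binary.Properties.Poset as PosetProperties
import Relation.Binary.Properties.TotalOrder as TotalOrderProperties
import Relation.Binary.Reasoning.PartialOrder as PartialOrderReasoning
open import Defs

-- A checkpoint resets the run to ψ, so the state tested at the next checkpoint depends only on the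
-- letters in between. That is what makes the segments independent of one another. The threshold δ
-- is uniform over all checkpoints because it is the infimum itself that exceeds λ₀, and the gap
-- above λ₀ pays for the approximation. Errors never accumulate: (1) alters a single segment, and in
-- (2) each segment of the tail starts afresh from ψ, so the gap below 1 pays for each of them
-- separately. The orbit is sampled at multiples of N + 1, so two visits to one cell are more than N
-- steps apart. Since the evolution is an isometry, the power common to both visits cancels and
-- leaves T(wᵏ)x close to x. The finite cover is built without square roots and without independence
-- of the generators. Gram-Schmidt residuals stay unnormalised, all lengths and distances are
-- squared, and a residual of length zero is split off by excluded middle.

-- Ring identities with integer coefficients

module IntegerSolver (R : CommutativeRing 0ℓ 0ℓ) where
  open CommutativeRing R renaming (zero to *-zero)
  open import Algebra.Properties.Ring ring using (-‿distribˡ-*; -‿distribʳ-*; -‿involutive; -0#≈0#)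
  open import Algebra.Properties.AbelianGroup +-abelianGroup using (⁻¹-∙-comm)
  open import Algebra.Properties.Semiring.Mult semiring using (×-homo-+; ×1-homo-*) renaming (_×_ to _×ⁿ_)
  open import Algebra.Solver.Ring.NaturalCoefficients.Default commutativeSemiring
    using () renaming (solve to solveⁿ; _:=_ to _:=ⁿ_; _:+_ to _:+ⁿ_; _:*_ to _:*ⁿ_)
  open import Relation.Binary.Reasoning.Setoid setoid

  private
    -- The integer m − n is encoded as (m , n), where m or n is 0 after reduction.
    reduce : ℕ → ℕ → ℕ × ℕ
    reduce (suc m) (suc n) = reduce m n
    reduce m       n       = m , n

    diff : ℕ × ℕ → Carrier
    diff (m , n) = m ×ⁿ 1# - n ×ⁿ 1#

    diff-reduce : ∀ m n → diff (reduce m n) ≈ diff (m , n)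
    diff-reduce zero    n       = refl
    diff-reduce (suc m) zero    = refl
    diff-reduce (suc m) (suc n) = begin
      diff (reduce m n)                       ≈⟨ diff-reduce m n ⟩
      p - q                                   ≈⟨ +-identityˡ _ ⟨
      0# + (p - q)                            ≈⟨ +-congʳ (-‿inverseʳ 1#) ⟨
      (1# - 1#) + (p - q)
        ≈⟨ solveⁿ 4 (λ a b c d → (a :+ⁿ b) :+ⁿ (c :+ⁿ d) :=ⁿ (a :+ⁿ c) :+ⁿ (b :+ⁿ d))
                                                   refl 1# (- 1#) p (- q) ⟩
      (1# + p) + (- 1# - q)                   ≈⟨ +-congˡ (⁻¹-∙-comm 1# q) ⟩
      (1# + p) - (1# + q)                     ∎
      where p = m ×ⁿ 1# ; q = n ×ⁿ 1#

    coefficients : RawRing 0ℓ 0ℓ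
    coefficients = record
      { Carrier = ℕ × ℕ
      ; _≈_     = _≡_
      ; _+_     = λ (m , n) (p , q) → reduce (m ℕ.+ p) (n ℕ.+ q)
      ; _*_     = λ (m , n) (p , q) → reduce (m ℕ.* p ℕ.+ n ℕ.* q) (m ℕ.* q ℕ.+ n ℕ.* p)
      ; -_      = λ (m , n) → n , m
      ; 0#      = 0 , 0
      ; 1#      = 1 , 0
      }

    +-homo : ∀ m n p q → diff (reduce (m ℕ.+ p) (n ℕ.+ q)) ≈ diff (m , n) + diff (p , q)
    +-homo m n p q = begin
      diff (reduce (m ℕ.+ p) (n ℕ.+ q))     ≈⟨ diff-reduce (m ℕ.+ p) (n ℕ.+ q) ⟩
      diff (m ℕ.+ p , n ℕ.+ q)              ≈⟨ +-cong (×-homo-+ 1# m p) (-‿cong (×-homo-+ 1# n q)) ⟩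
      (m′ + p′) - (n′ + q′)              ≈⟨ +-congˡ (⁻¹-∙-comm n′ q′) ⟨
      (m′ + p′) + (- n′ - q′)
        ≈⟨ solveⁿ 4 (λ a b c d → (a :+ⁿ b) :+ⁿ (c :+ⁿ d) :=ⁿ (a :+ⁿ c) :+ⁿ (b :+ⁿ d))
                                              refl m′ p′ (- n′) (- q′) ⟩
      (m′ - n′) + (p′ - q′)              ∎
      where m′ = m ×ⁿ 1# ; n′ = n ×ⁿ 1# ; p′ = p ×ⁿ 1# ; q′ = q ×ⁿ 1#

    neg*neg : ∀ x y → (- x) * (- y) ≈ x * y
    neg*neg x y = begin
      (- x) * (- y)  ≈⟨ -‿distribˡ-* x (- y) ⟨
      - (x * (- y))  ≈⟨ -‿cong (-‿distribʳ-* x y) ⟨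
      - - (x * y)    ≈⟨ -‿involutive _ ⟩
      x * y          ∎

    ×1-homo-*+* : ∀ m n p q → (m ℕ.* n ℕ.+ p ℕ.* q) ×ⁿ 1# ≈
                  (m ×ⁿ 1#) * (n ×ⁿ 1#) + (p ×ⁿ 1#) * (q ×ⁿ 1#)
    ×1-homo-*+* m n p q = trans (×-homo-+ 1# (m ℕ.* n) (p ℕ.* q)) (+-cong (×1-homo-* m n) (×1-homo-* p q))

    *-homo : ∀ m n p q → diff (reduce (m ℕ.* p ℕ.+ n ℕ.* q) (m ℕ.* q ℕ.+ n ℕ.* p)) ≈ diff (m , n) * diff (p , q)
    *-homo m n p q = begin
      diff (reduce (m ℕ.* p ℕ.+ n ℕ.* q) (m ℕ.* q ℕ.+ n ℕ.* p))
        ≈⟨ diff-reduce (m ℕ.* p ℕ.+ n ℕ.* q) (m ℕ.* q ℕ.+ n ℕ.* p) ⟩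
      diff (m ℕ.* p ℕ.+ n ℕ.* q , m ℕ.* q ℕ.+ n ℕ.* p)
        ≈⟨ +-cong (×1-homo-*+* m p n q) (-‿cong (×1-homo-*+* m q n p)) ⟩
      (m′ * p′ + n′ * q′) - (m′ * q′ + n′ * p′)
        ≈⟨ +-cong (+-congˡ (neg*neg n′ q′)) (⁻¹-∙-comm _ _) ⟨
      (m′ * p′ + (- n′) * (- q′)) + (- (m′ * q′) - n′ * p′)
        ≈⟨ +-congˡ (+-cong (-‿distribʳ-* m′ q′) (-‿distribˡ-* n′ p′)) ⟩
      (m′ * p′ + (- n′) * (- q′)) + (m′ * (- q′) + (- n′) * p′)
        ≈⟨ solveⁿ 4 (λ a b c d → (a :*ⁿ c :+ⁿ b :*ⁿ d) :+ⁿ (a :*ⁿ d :+ⁿ b :*ⁿ c) :=ⁿ (a :+ⁿ b) :*ⁿ (c :+ⁿ d))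
             refl m′ (- n′) p′ (- q′) ⟩
      (m′ - n′) * (p′ - q′) ∎
      where
      m′ = m ×ⁿ 1# ; n′ = n ×ⁿ 1# ; p′ = p ×ⁿ 1# ; q′ = q ×ⁿ 1#

    -‿homo : ∀ m n → diff (n , m) ≈ - diff (m , n)
    -‿homo m n = begin
      n′ - m′      ≈⟨ +-comm n′ (- m′) ⟩
      - m′ + n′    ≈⟨ +-congˡ (-‿involutive n′) ⟨
      - m′ - - n′  ≈⟨ ⁻¹-∙-comm m′ (- n′) ⟩
      - (m′ - n′)  ∎
      where m′ = m ×ⁿ 1# ; n′ = n ×ⁿ 1#

    -- diff up to ≈, but with the values of con (0 , 0) and con (1 , 0) being 0# and 1# on the nose.
    ⟦_⟧ : ℕ × ℕ → Carrier
    ⟦ 0 , 0 ⟧ = 0#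
    ⟦ 1 , 0 ⟧ = 1#
    ⟦ m , n ⟧ = diff (m , n)

    ⟦⟧≈diff : ∀ x → ⟦ x ⟧ ≈ diff x
    ⟦⟧≈diff (0           , 0)     = sym (-‿inverseʳ 0#)
    ⟦⟧≈diff (1           , 0)     = sym (trans (+-cong (+-identityʳ 1#) -0#≈0#) (+-identityʳ 1#))
    ⟦⟧≈diff (0           , suc n) = refl
    ⟦⟧≈diff (1           , suc n) = refl
    ⟦⟧≈diff (suc (suc m) , n)     = refl

    morphism : coefficients -Raw-AlmostCommutative⟶ fromCommutativeRing R
    morphism = record
      { ⟦_⟧    = ⟦_⟧
      ; +-homo = λ x@(m , n) y@(p , q) →
          trans (⟦⟧≈diff (reduce (m ℕ.+ p) (n ℕ.+ q))) (trans (+-homo m n p q) (sym (+-cong (⟦⟧≈diff x) (⟦⟧≈diff y))))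
      ; *-homo = λ x@(m , n) y@(p , q) →
          trans (⟦⟧≈diff (reduce (m ℕ.* p ℕ.+ n ℕ.* q) (m ℕ.* q ℕ.+ n ℕ.* p)))
            (trans (*-homo m n p q) (sym (*-cong (⟦⟧≈diff x) (⟦⟧≈diff y))))
      ; -‿homo = λ x@(m , n) →
          trans (⟦⟧≈diff (n , m)) (trans (-‿homo m n) (sym (-‿cong (⟦⟧≈diff x))))
      ; 0-homo = refl
      ; 1-homo = refl
      }

    -- Comparing codes recognises equal integers because sums and products are reduced and negation
    -- keeps a code reduced, so each integer that occurs has one code.
    _≟_ : ∀ x y → Maybe (⟦ x ⟧ ≈ ⟦ y ⟧)
    (m , n) ≟ (p , q) with m ℕ.≟ p | n ℕ.≟ q
    ... | yes ≡.refl | yes ≡.refl = just refl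
    ... | _          | _          = nothing

  open import Algebra.Solver.Ring coefficients (fromCommutativeRing R) morphism _≟_ public
    using (solve; con; _:=_; _:+_; _:*_; _:-_; :-_)

-- Ordered-field estimates and finite covers of intervals

-- Total boundedness of `P` at one fixed scale. Cells may overlap and may leave `P`: the pigeonhole
-- principle asks only for a choice of cell for each point.
record Cover {X : Set} (P : Pred X 0ℓ) (_~_ : Rel X 0ℓ) : Set₁ where
  field
    size   : ℕ
    Cell   : Fin size → Pred X 0ℓ
    covers : ∀ x → P x → ∃ λ m → Cell m x
    small  : ∀ m x y → Cell m x → Cell m y → x ~ y

module OrderedField (em : ExcludedMiddle 0ℓ) (ℝ : CompleteOrderedField) where
  open CompleteOrderedField ℝ renaming (zero to *-zero)
  open IntegerSolver commutativeRing public
  open IsTotalOrder isTotalOrder public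
    using (antisym; total; ≤-respˡ-≈; ≤-respʳ-≈)
    renaming (reflexive to ≤-reflexive; refl to ≤-refl; trans to ≤-trans)

  totalOrder : TotalOrder 0ℓ 0ℓ 0ℓ
  totalOrder = record { isTotalOrder = isTotalOrder }

  open PartialOrderReasoning (TotalOrder.poset totalOrder) public

  open PosetProperties (TotalOrder.poset totalOrder) public using (<⇒≱)
  open TotalOrderProperties totalOrder public using (≰⇒>)

  ≮⇒≥ : ∀ {x y} → ¬ x < y → y ≤ x
  ≮⇒≥ {x} {y} x≮y with em {y ≤ x}
  ... | yes y≤x = y≤x
  ... | no  y≰x = ⊥-elim (x≮y (≰⇒> y≰x))

  <-≤-trans : ∀ {x y z} → x < y → y ≤ z → x < z
  <-≤-trans {x} {y} {z} x<y y≤z = begin-strict x <⟨ x<y ⟩ y ≤⟨ y≤z ⟩ z ∎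

  +-mono-≤ : ∀ {x y u v} → x ≤ y → u ≤ v → x + u ≤ y + v
  +-mono-≤ {x} {y} {u} {v} x≤y u≤v = begin
    x + u ≤⟨ +-monoʳ-≤ x u≤v ⟩
    x + v ≈⟨ +-comm x v ⟩
    v + x ≤⟨ +-monoʳ-≤ v x≤y ⟩
    v + y ≈⟨ +-comm v y ⟩
    y + v ∎

  +-nonNeg : ∀ {x y} → 0# ≤ x → 0# ≤ y → 0# ≤ x + y
  +-nonNeg 0≤x 0≤y = ≤-respˡ-≈ (+-identityˡ 0#) (+-mono-≤ 0≤x 0≤y)

  x≤y⇒0≤y-x : ∀ {x y} → x ≤ y → 0# ≤ y - x
  x≤y⇒0≤y-x {x} {y} x≤y = begin
    0#      ≈⟨ -‿inverseˡ x ⟨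
    - x + x ≤⟨ +-monoʳ-≤ (- x) x≤y ⟩
    - x + y ≈⟨ +-comm (- x) y ⟩
    y - x   ∎

  0≤y-x⇒x≤y : ∀ {x y} → 0# ≤ y - x → x ≤ y
  0≤y-x⇒x≤y {x} {y} 0≤y-x = begin
    x           ≈⟨ +-identityʳ x ⟨
    x + 0#      ≤⟨ +-monoʳ-≤ x 0≤y-x ⟩
    x + (y - x) ≈⟨ solve 2 (λ x y → x :+ (y :- x) := y) refl x y ⟩
    y           ∎

  x<y⇒0<y-x : ∀ {x y} → x < y → 0# < y - x
  x<y⇒0<y-x {x} {y} (x≤y , x≉y) = x≤y⇒0≤y-x x≤y , λ 0≈y-x → x≉y (begin-equality
    x           ≈⟨ +-identityʳ x ⟨
    x + 0#      ≈⟨ +-congˡ 0≈y-x ⟩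
    x + (y - x) ≈⟨ solve 2 (λ x y → x :+ (y :- x) := y) refl x y ⟩
    y           ∎)

  x≤x+y : ∀ {x y} → 0# ≤ y → x ≤ x + y
  x≤x+y {x} 0≤y = ≤-respˡ-≈ (+-identityʳ x) (+-monoʳ-≤ x 0≤y)

  x<x+y : ∀ {x y} → 0# < y → x < x + y
  x<x+y {x} {y} (0≤y , 0≉y) = x≤x+y 0≤y , λ x≈x+y → 0≉y (begin-equality
    0#          ≈⟨ -‿inverseʳ x ⟨
    x - x       ≈⟨ +-congʳ x≈x+y ⟩
    (x + y) - x ≈⟨ solve 2 (λ x y → (x :+ y) :- x := y) refl x y ⟩
    y           ∎)

  *-monoˡ-≤ : ∀ {x y z} → 0# ≤ z → x ≤ y → x * z ≤ y * z
  *-monoˡ-≤ {x} {y} {z} 0≤z x≤y = 0≤y-x⇒x≤y (begin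
    0#            ≤⟨ *-nonNeg (x≤y⇒0≤y-x x≤y) 0≤z ⟩
    (y - x) * z   ≈⟨ solve 3 (λ x y z → (y :- x) :* z := y :* z :- x :* z) refl x y z ⟩
    y * z - x * z ∎)

  x²-nonNeg : ∀ x → 0# ≤ x * x
  x²-nonNeg x with total 0# x
  ... | inj₁ 0≤x = *-nonNeg 0≤x 0≤x
  ... | inj₂ x≤0 = begin
    0#                    ≤⟨ *-nonNeg (x≤y⇒0≤y-x x≤0) (x≤y⇒0≤y-x x≤0) ⟩
    (0# - x) * (0# - x)   ≈⟨ solve 1 (λ x → (con (0 , 0) :- x) :* (con (0 , 0) :- x) := x :* x) refl x ⟩
    x * x                 ∎

  0<1 : 0# < 1#
  0<1 = ≤-respʳ-≈ (*-identityˡ 1#) (x²-nonNeg 1#) , 0≉1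

  *-pos : ∀ {x y} → 0# < x → 0# < y → 0# < x * y
  *-pos {x} {y} (0≤x , 0≉x) (0≤y , 0≉y) = *-nonNeg 0≤x 0≤y , λ 0≈xy →
    let x⁻¹ , xx⁻¹≈1 = inverse x (λ x≈0 → 0≉x (sym x≈0)) in
    0≉y (begin-equality
      0#              ≈⟨ zeroʳ x⁻¹ ⟨
      x⁻¹ * 0#        ≈⟨ *-congˡ 0≈xy ⟩
      x⁻¹ * (x * y)   ≈⟨ solve 3 (λ x x⁻¹ y → x⁻¹ :* (x :* y) := (x :* x⁻¹) :* y) refl x x⁻¹ y ⟩
      (x * x⁻¹) * y   ≈⟨ *-congʳ xx⁻¹≈1 ⟩
      1# * y          ≈⟨ *-identityˡ y ⟩
      y               ∎)

  *-cancelˡ-≤ : ∀ {x y z} → 0# < z → z * x ≤ z * y → x ≤ y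
  *-cancelˡ-≤ {x} {y} {z} 0<z zx≤zy = ≮⇒≥ λ y<x → <⇒≱ (*-pos 0<z (x<y⇒0<y-x y<x)) (begin
    z * (x - y)      ≈⟨ solve 3 (λ x y z → z :* (x :- y) := z :* x :- z :* y) refl x y z ⟩
    z * x - z * y    ≤⟨ +-mono-≤ zx≤zy ≤-refl ⟩
    z * y - z * y    ≈⟨ -‿inverseʳ (z * y) ⟩
    0#               ∎)

  positiveInverse : ∀ {x} → 0# < x → ∃ λ y → 0# < y × x * y ≈ 1#
  positiveInverse {x} (0≤x , 0≉x) with inverse x (λ x≈0 → 0≉x (sym x≈0))
  ... | y , xy≈1 = y , ≰⇒> (λ y≤0 → <⇒≱ 0<1 (begin
    1#                       ≈⟨ xy≈1 ⟨
    x * y                    ≈⟨ *-comm x y ⟩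
    y * x                    ≤⟨ *-monoˡ-≤ 0≤x y≤0 ⟩
    0# * x                   ≈⟨ zeroˡ x ⟩
    0#                       ∎)) , xy≈1

  half : ∀ {x} → 0# < x → ∃ λ t → 0# < t × x ≈ t + t
  half {x} 0<x = let q , 0<q , 2q≈1 = positiveInverse (<-≤-trans 0<1 (x≤x+y (proj₁ 0<1))) in
    x * q , *-pos 0<x 0<q , (begin-equality
    x                   ≈⟨ *-identityʳ x ⟨
    x * 1#              ≈⟨ *-congˡ 2q≈1 ⟨
    x * ((1# + 1#) * q) ≈⟨ *-congˡ (distribʳ q 1# 1#) ⟩
    x * (1# * q + 1# * q) ≈⟨ *-congˡ (+-cong (*-identityˡ q) (*-identityˡ q)) ⟩
    x * (q + q)         ≈⟨ distribˡ x q q ⟩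
    x * q + x * q       ∎)

  -- The quarter t of the gap b - a works, since b - 2t is then the midpoint. The form `t + t`
  -- matches the loss in `fidelity-continuous`.
  between : ∀ {a b} → a < b → ∃ λ t → 0# < t × a < b - (t + t)
  between {a} {b} a<b =
    let d , 0<d , b-a≈2d = half (x<y⇒0<y-x a<b)
        t , 0<t , d≈2t   = half 0<d
    in t , 0<t , (begin-strict
    a                         <⟨ x<x+y 0<d ⟩
    a + d                     ≈⟨ solve 2 (λ a d → a :+ d := (a :+ (d :+ d)) :- d) refl a d ⟩
    (a + (d + d)) - d         ≈⟨ +-cong (+-congˡ b-a≈2d) refl ⟨
    (a + (b - a)) - d         ≈⟨ solve 3 (λ a b d → (a :+ (b :- a)) :- d := b :- d) refl a b d ⟩
    b - d                     ≈⟨ +-congˡ (-‿cong d≈2t) ⟩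
    b - (t + t)               ∎)

  open SemiringMult semiring using () renaming (_×_ to _×ʳ_)

  -- Were the multiples of h bounded, they would have a supremum s. Adding h to a multiple gives a
  -- multiple, so s - h would be an upper bound too, contradicting that s is least.
  archimedean : ∀ {h} → 0# < h → ∀ K → ∃ λ n → K ≤ n ×ʳ h
  archimedean {h} 0<h K with em {∃ λ n → K ≤ n ×ʳ h}
  ... | yes p = p
  ... | no ¬p = ⊥-elim (<⇒≱ (x<x+y 0<h) (begin
      s + h            ≤⟨ +-mono-≤ (least (s - h) below) ≤-refl ⟩
      (s - h) + h      ≈⟨ solve 2 (λ s h → (s :- h) :+ h := s) refl s h ⟩
      s                ∎))
    where
    Multiple : Pred Carrier 0ℓ
    Multiple x = ∃ λ n → x ≈ n ×ʳ h
    sup = complete Multiple (0# , 0 , refl)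
      (K , λ x (n , x≈nh) → ≤-respˡ-≈ (sym x≈nh) (proj₁ (≰⇒> λ K≤nh → ¬p (n , K≤nh))))
    s = proj₁ sup
    least = proj₂ (proj₂ sup)
    below : UpperBound Multiple (s - h)
    below x (n , x≈nh) = begin
      x                ≈⟨ solve 2 (λ h x → x := (h :+ x) :- h) refl h x ⟩
      (h + x) - h      ≤⟨ +-mono-≤ (proj₁ (proj₂ sup) (h + x) (suc n , +-congˡ x≈nh)) ≤-refl ⟩
      s - h            ∎

  -- 1 + y is a crude stand-in for the square root of y: its square is at least y + 1.
  x²≤y⇒x≤1+y : ∀ {x y} → 0# ≤ y → x * x ≤ y → x ≤ 1# + y
  x²≤y⇒x≤1+y {x} {y} 0≤y x²≤y = ≮⇒≥ λ (1+y≤x , _) → <⇒≱ (x<x+y 0<1) (begin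
    y + 1#                             ≤⟨ x≤x+y (+-nonNeg 0≤y (x²-nonNeg y)) ⟩
    (y + 1#) + (y + y * y)
      ≈⟨ solve 1 (λ y → (y :+ con (1 , 0)) :+ (y :+ y :* y) := (con (1 , 0) :+ y) :* (con (1 , 0) :+ y)) refl y ⟩
    (1# + y) * (1# + y)                ≤⟨ *-monoˡ-≤ 0≤1+y 1+y≤x ⟩
    x * (1# + y)                       ≈⟨ *-comm x (1# + y) ⟩
    (1# + y) * x                       ≤⟨ *-monoˡ-≤ (≤-trans 0≤1+y 1+y≤x) 1+y≤x ⟩
    x * x                              ≤⟨ x²≤y ⟩
    y                                  ∎)
    where
    0≤1+y = +-nonNeg (proj₁ 0<1) 0≤y

  x²≤y² : ∀ {x y} → - y ≤ x → x ≤ y → x * x ≤ y * y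
  x²≤y² {x} {y} -y≤x x≤y = 0≤y-x⇒x≤y (begin
    0#                      ≤⟨ *-nonNeg (x≤y⇒0≤y-x x≤y) (x≤y⇒0≤y-x -y≤x) ⟩
    (y - x) * (x - - y)     ≈⟨ solve 2 (λ x y → (y :- x) :* (x :- :- y) := y :* y :- x :* x) refl x y ⟩
    y * y - x * x           ∎)

  -- The square root of ε / N is replaced by h = min(k, 1) with k = ε / (1 + N). Then h² ≤ h ≤ k,
  -- hence h²N ≤ k(1 + N) = ε, and N = 0 is no exception.
  small-square : ∀ {ε N} → 0# < ε → 0# ≤ N → ∃ λ h → 0# < h × h * h * N ≤ ε
  small-square {ε} {N} 0<ε 0≤N = let q , 0<q , [1+N]q≈1 = positiveInverse (<-≤-trans 0<1 (x≤x+y 0≤N)) in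
    choose (*-pos 0<ε 0<q) (begin-equality
      ε * q * (1# + N)    ≈⟨ solve 3 (λ ε q M → ε :* q :* M := ε :* (M :* q)) refl ε q (1# + N) ⟩
      ε * ((1# + N) * q)  ≈⟨ *-congˡ [1+N]q≈1 ⟩
      ε * 1#              ≈⟨ *-identityʳ ε ⟩
      ε                   ∎)
    where
    choose : ∀ {k} → 0# < k → k * (1# + N) ≈ ε → ∃ λ h → 0# < h × h * h * N ≤ ε
    choose {k} 0<k k[1+N]≈ε with total k 1#
    ... | inj₁ k≤1 = k , 0<k , (begin
      k * k * N           ≤⟨ *-monoˡ-≤ 0≤N (*-monoˡ-≤ (proj₁ 0<k) k≤1) ⟩
      1# * k * N          ≤⟨ x≤x+y (proj₁ 0<k) ⟩
      1# * k * N + k      ≈⟨ solve 2 (λ k N → con (1 , 0) :* k :* N :+ k := k :* (con (1 , 0) :+ N)) refl k N ⟩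
      k * (1# + N)        ≈⟨ k[1+N]≈ε ⟩
      ε                   ∎)
    ... | inj₂ 1≤k = 1# , 0<1 , (begin
      1# * 1# * N         ≤⟨ x≤x+y (proj₁ 0<1) ⟩
      1# * 1# * N + 1#
        ≈⟨ solve 1 (λ N → con (1 , 0) :* con (1 , 0) :* N :+ con (1 , 0) := con (1 , 0) :* (con (1 , 0) :+ N)) refl N ⟩
      1# * (1# + N)       ≤⟨ *-monoˡ-≤ (+-nonNeg (proj₁ 0<1) 0≤N) 1≤k ⟩
      k * (1# + N)        ≈⟨ k[1+N]≈ε ⟩
      ε                   ∎)

  -- Consecutive intervals of length h starting at a. There are n + 1 of them, so that the single
  -- point left when n = 0 also gets a cell.
  interval-cover : ∀ {h} → 0# ≤ h → ∀ n a →
    Cover (λ x → a ≤ x × x ≤ a + n ×ʳ h) (λ x y → (x - y) * (x - y) ≤ h * h)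
  interval-cover {h} 0≤h n a = record
    { size = suc n ; Cell = Cell n a ; covers = covers n a ; small = small n a }
    where
    Cell : ∀ n → Carrier → Fin (suc n) → Pred Carrier 0ℓ
    Cell n       a zero    x = a ≤ x × x ≤ a + h
    Cell (suc n) a (suc m) x = Cell n (a + h) m x

    covers : ∀ n a x → a ≤ x × x ≤ a + n ×ʳ h → ∃ λ m → Cell n a m x
    covers zero    a x (a≤x , x≤a) = zero , a≤x , ≤-trans x≤a (+-mono-≤ ≤-refl 0≤h)
    covers (suc n) a x (a≤x , x≤b) with total x (a + h)
    ... | inj₁ x≤a+h = zero , a≤x , x≤a+h
    ... | inj₂ a+h≤x with covers n (a + h) x (a+h≤x , ≤-respʳ-≈ (sym (+-assoc a h (n ×ʳ h))) x≤b)
    ...   | m , x∈m = suc m , x∈m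

    small : ∀ n a m x y → Cell n a m x → Cell n a m y → (x - y) * (x - y) ≤ h * h
    small (suc n) a (suc m) x y p q = small n (a + h) m x y p q
    small n       a zero    x y (a≤x , x≤a+h) (a≤y , y≤a+h) = x²≤y²
      (0≤y-x⇒x≤y (begin
        0#                       ≤⟨ +-nonNeg (x≤y⇒0≤y-x a≤x) (x≤y⇒0≤y-x y≤a+h) ⟩
        (x - a) + ((a + h) - y)
          ≈⟨ solve 4 (λ a h x y → (x :- a) :+ ((a :+ h) :- y) := (x :- y) :- :- h) refl a h x y ⟩
        (x - y) - - h            ∎))
      (0≤y-x⇒x≤y (begin
        0#                       ≤⟨ +-nonNeg (x≤y⇒0≤y-x a≤y) (x≤y⇒0≤y-x x≤a+h) ⟩
        (y - a) + ((a + h) - x)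
          ≈⟨ solve 4 (λ a h x y → (y :- a) :+ ((a :+ h) :- x) := h :- (x :- y)) refl a h x y ⟩
        h - (x - y)              ∎))

  -- For a coordinate a along a vector of squared length N, so that a²N is the squared length of the
  -- component. If N = 0, the coordinate is unbounded but irrelevant, and one cell takes everything.
  -- Otherwise it lies in [-K, K] with K = 1 + B / N, which is cut into pieces of length h with h²N
  -- ≤ ε.
  scaled-cover : ∀ {N B ε} → 0# ≤ N → 0# ≤ B → 0# < ε →
    Cover (λ a → a * a * N ≤ B) (λ a b → (a - b) * (a - b) * N ≤ ε)
  scaled-cover {N} {B} {ε} 0≤N 0≤B 0<ε with em {0# ≈ N}
  ... | yes 0≈N = record
    { size   = 1
    ; Cell   = λ _ _ → ⊤
    ; covers = λ _ _ → zero , tt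
    ; small  = λ _ x y _ _ → ≤-trans (≤-reflexive (trans (*-congˡ (sym 0≈N)) (zeroʳ _))) (proj₁ 0<ε)
    }
  ... | no 0≉N = record
    { size   = size
    ; Cell   = Cell
    ; covers = λ x x²N≤B → covers x
        ( neg-below (bounded (≤-respˡ-≈ (*-congʳ (solve 1 (λ x → x :* x := (:- x) :* (:- x)) refl x)) x²N≤B))
        , (begin
             x                       ≤⟨ bounded x²N≤B ⟩
             K                       ≈⟨ solve 1 (λ K → K := (:- K) :+ (K :+ K)) refl K ⟩
             - K + (K + K)           ≤⟨ +-monoʳ-≤ (- K) 2K≤nh ⟩
             - K + n ×ʳ h            ∎))
    ; small  = λ m x y p q → ≤-trans (*-monoˡ-≤ 0≤N (small m x y p q)) h²N≤ε
    }
    where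
    N⁻¹ = positiveInverse (0≤N , 0≉N)
    q = proj₁ N⁻¹
    0<q = proj₁ (proj₂ N⁻¹)
    Nq≈1 = proj₂ (proj₂ N⁻¹)
    step = small-square 0<ε 0≤N
    h = proj₁ step
    0<h = proj₁ (proj₂ step)
    h²N≤ε = proj₂ (proj₂ step)
    K = 1# + B * q
    n = proj₁ (archimedean 0<h (K + K))
    2K≤nh = proj₂ (archimedean 0<h (K + K))
    open Cover (interval-cover (proj₁ 0<h) n (- K))
    bounded : ∀ {x} → x * x * N ≤ B → x ≤ K
    bounded {x} x²N≤B = x²≤y⇒x≤1+y (*-nonNeg 0≤B (proj₁ 0<q)) (begin
      x * x              ≈⟨ *-identityʳ _ ⟨
      x * x * 1#         ≈⟨ *-congˡ Nq≈1 ⟨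
      x * x * (N * q)    ≈⟨ *-assoc (x * x) N q ⟨
      x * x * N * q      ≤⟨ *-monoˡ-≤ (proj₁ 0<q) x²N≤B ⟩
      B * q              ∎)
    neg-below : ∀ {x} → - x ≤ K → - K ≤ x
    neg-below {x} -x≤K = 0≤y-x⇒x≤y (≤-respʳ-≈ (solve 2 (λ x K → K :- :- x := x :- :- K) refl x K) (x≤y⇒0≤y-x -x≤K))

-- Suprema and infima of families

module SupremaProperties (em : ExcludedMiddle 0ℓ) (ℝ : CompleteOrderedField) where
  open CompleteOrderedField ℝ renaming (zero to *-zero)
  open OrderedField em ℝ
  open Suprema em ℝ

  module _ {I : Set} (f : I → Carrier) where

    ⨆-isSup : I → ∀ b → (∀ i → f i ≤ b) → IsSup (range f) (⨆ f)
    ⨆-isSup i b f≤b with em {∃ (IsSup (range f))}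
    ... | yes (_ , isSup) = isSup
    ... | no  ¬sup        = ⊥-elim (¬sup (complete (range f) (f i , i , refl)
                              (b , λ x (j , x≈fj) → ≤-respˡ-≈ (sym x≈fj) (f≤b j))))

    -- The bound `0# ≤ b` covers the default value that `⨆` takes when there is no supremum. Thus I
    -- may be empty, as `UnitVectorInF` is when F is the zero subspace.
    ⨆-≤ : ∀ {b} → 0# ≤ b → (∀ i → f i ≤ b) → ⨆ f ≤ b
    ⨆-≤ {b} 0≤b f≤b with em {∃ (IsSup (range f))}
    ... | yes (_ , _ , least) = least b λ x (i , x≈fi) → ≤-respˡ-≈ (sym x≈fi) (f≤b i)
    ... | no  _               = 0≤b

    <⨆⇒∃< : ∀ {b} → 0# ≤ b → b < ⨆ f → ∃ λ i → b < f i
    <⨆⇒∃< {b} 0≤b b<⨆f with em {∃ λ i → b < f i}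
    ... | yes p = p
    ... | no ¬p = ⊥-elim (<⇒≱ b<⨆f (⨆-≤ 0≤b λ i → ≮⇒≥ λ b<fi → ¬p (i , b<fi)))

    f≤⨆ : ∀ b → (∀ i → f i ≤ b) → ∀ i → f i ≤ ⨆ f
    f≤⨆ b f≤b i = proj₁ (⨆-isSup i b f≤b) (f i) (i , refl)

    -- Completeness is postulated for suprema, so the infimum is obtained as the supremum of the set
    -- of lower bounds.
    ⨅-isInf : I → ∀ b → (∀ i → b ≤ f i) → IsInf (range f) (⨅ f)
    ⨅-isInf i b b≤f with em {∃ (IsInf (range f))}
    ... | yes (_ , isInf) = isInf
    ... | no  ¬inf        = ⊥-elim (¬inf (s , (λ x x∈f → least x λ y y∈ → y∈ x x∈f) , upper))
      where
      sup = complete (LowerBound (range f))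
        (b , λ x (j , x≈fj) → ≤-respʳ-≈ (sym x≈fj) (b≤f j))
        (f i , λ y y∈ → y∈ (f i) (i , refl))
      s     = proj₁ sup
      upper = proj₁ (proj₂ sup)
      least = proj₂ (proj₂ sup)

    ⨅≤f : (∀ i → 0# ≤ f i) → ∀ i → ⨅ f ≤ f i
    ⨅≤f 0≤f i = proj₁ (⨅-isInf i 0# 0≤f) (f i) (i , refl)

    b≤⨅ : I → ∀ {b} → (∀ i → b ≤ f i) → b ≤ ⨅ f
    b≤⨅ i {b} b≤f = proj₂ (⨅-isInf i b b≤f) b λ x (j , x≈fj) → ≤-respʳ-≈ (sym x≈fj) (b≤f j)

-- Real inner product spaces: projections and total boundedness

-- `x ⊕[ a ] y` stands for x + ay. Vectors are known only through their inner products: `Vec` has no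
-- equality and no named zero, so that vanishing means orthogonality to everything, as in the
-- conclusion of `definite`.
record RealInnerProductSpace (ℝ : CompleteOrderedField) : Set₁ where
  open CompleteOrderedField ℝ using (Carrier; _≈_; _≤_; _+_; _*_; 0#)
  infixl 6 _⊕[_]_
  field
    Vec      : Set
    ⟪_,_⟫    : Vec → Vec → Carrier
    ⟪⟫-sym   : ∀ x y → ⟪ x , y ⟫ ≈ ⟪ y , x ⟫
    _⊕[_]_   : Vec → Carrier → Vec → Vec
    ⟪⟫-⊕     : ∀ x a y z → ⟪ x ⊕[ a ] y , z ⟫ ≈ ⟪ x , z ⟫ + a * ⟪ y , z ⟫
    nonNeg   : ∀ x → 0# ≤ ⟪ x , x ⟫
    definite : ∀ x → ⟪ x , x ⟫ ≈ 0# → ∀ y → ⟪ x , y ⟫ ≈ 0#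

module InnerProduct (em : ExcludedMiddle 0ℓ) (ℝ : CompleteOrderedField) (E : RealInnerProductSpace ℝ) where
  open CompleteOrderedField ℝ renaming (zero to *-zero)
  open OrderedField em ℝ
  open RealInnerProductSpace E

  dist² : Vec → Vec → Carrier
  dist² x y = (⟪ x , x ⟫ + ⟪ y , y ⟫) - (⟪ x , y ⟫ + ⟪ x , y ⟫)

  -- Membership only constrains the inner products with x, so that no vector arithmetic is needed.
  Span : List Vec → Pred Vec 0ℓ
  Span []       x = ∀ z → ⟪ x , z ⟫ ≈ 0#
  Span (v ∷ vs) x = ∃ λ y → ∃ λ a → Span vs y × (∀ z → ⟪ x , z ⟫ ≈ ⟪ y , z ⟫ + a * ⟪ v , z ⟫)

  Span-⊕ : ∀ vs {x y} a → Span vs x → Span vs y → Span vs (x ⊕[ a ] y)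
  Span-⊕ [] {x} {y} a x≈0 y≈0 z = begin-equality
    ⟪ x ⊕[ a ] y , z ⟫        ≈⟨ ⟪⟫-⊕ x a y z ⟩
    ⟪ x , z ⟫ + a * ⟪ y , z ⟫ ≈⟨ +-cong (x≈0 z) (*-congˡ (y≈0 z)) ⟩
    0# + a * 0#               ≈⟨ +-identityˡ (a * 0#) ⟩
    a * 0#                    ≈⟨ zeroʳ a ⟩
    0#                        ∎
  Span-⊕ (v ∷ vs) {x} {y} a (x′ , b , x′∈ , x≈) (y′ , c , y′∈ , y≈) =
    x′ ⊕[ a ] y′ , b + a * c , Span-⊕ vs a x′∈ y′∈ , λ z → begin-equality
      ⟪ x ⊕[ a ] y , z ⟫                                              ≈⟨ ⟪⟫-⊕ x a y z ⟩
      ⟪ x , z ⟫ + a * ⟪ y , z ⟫                                       ≈⟨ +-cong (x≈ z) (*-congˡ (y≈ z)) ⟩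
      (⟪ x′ , z ⟫ + b * ⟪ v , z ⟫) + a * (⟪ y′ , z ⟫ + c * ⟪ v , z ⟫)
        ≈⟨ rearrange ⟪ x′ , z ⟫ b ⟪ v , z ⟫ a ⟪ y′ , z ⟫ c ⟩
      (⟪ x′ , z ⟫ + a * ⟪ y′ , z ⟫) + (b + a * c) * ⟪ v , z ⟫         ≈⟨ +-congʳ (⟪⟫-⊕ x′ a y′ z) ⟨
      ⟪ x′ ⊕[ a ] y′ , z ⟫ + (b + a * c) * ⟪ v , z ⟫                  ∎
    where
    rearrange : ∀ p b q a r c → (p + b * q) + a * (r + c * q) ≈ (p + a * r) + (b + a * c) * q
    rearrange = solve 6 (λ p b q a r c → (p :+ b :* q) :+ a :* (r :+ c :* q) := (p :+ a :* r) :+ (b :+ a :* c) :* q) refl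

  IsProjection : List Vec → Vec → Vec → Set
  IsProjection vs z p = Span vs p × (∀ x → Span vs x → ⟪ x , z ⟫ ≈ ⟪ x , p ⟫)

  -- One Gram-Schmidt step: r is the component of v orthogonal to the span of `vs`. It is not
  -- normalised, and N is zero when v depends on `vs`.
  module Residual (vs : List Vec) (v p : Vec) (isProj : IsProjection vs v p) where
    r : Vec
    r = v ⊕[ - 1# ] p

    N : Carrier
    N = ⟪ r , r ⟫

    ⟪r,⟫ : ∀ z → ⟪ r , z ⟫ ≈ ⟪ v , z ⟫ - ⟪ p , z ⟫
    ⟪r,⟫ z = trans (⟪⟫-⊕ v (- 1#) p z)
      (solve 2 (λ a b → a :+ (:- con (1 , 0)) :* b := a :- b) refl ⟪ v , z ⟫ ⟪ p , z ⟫)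

    ⟪y,r⟫≈0 : ∀ y → Span vs y → ⟪ y , r ⟫ ≈ 0#
    ⟪y,r⟫≈0 y y∈ = begin-equality
      ⟪ y , r ⟫             ≈⟨ ⟪⟫-sym y r ⟩
      ⟪ r , y ⟫             ≈⟨ ⟪r,⟫ y ⟩
      ⟪ v , y ⟫ - ⟪ p , y ⟫ ≈⟨ +-cong (⟪⟫-sym v y) (-‿cong (⟪⟫-sym p y)) ⟩
      ⟪ y , v ⟫ - ⟪ y , p ⟫ ≈⟨ +-congʳ (proj₂ isProj y y∈) ⟩
      ⟪ y , p ⟫ - ⟪ y , p ⟫ ≈⟨ -‿inverseʳ _ ⟩
      0#                    ∎

    Decomposes : Vec → Vec → Carrier → Set
    Decomposes x y a = Span vs y × (∀ z → ⟪ x , z ⟫ ≈ ⟪ y , z ⟫ + a * ⟪ r , z ⟫)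

    decompose : ∀ x → Span (v ∷ vs) x → ∃ λ y → ∃ λ a → Decomposes x y a
    decompose x (y , a , y∈ , x≈) = y ⊕[ a ] p , a , Span-⊕ vs a y∈ (proj₁ isProj) , λ z → begin-equality
      ⟪ x , z ⟫                                                   ≈⟨ x≈ z ⟩
      ⟪ y , z ⟫ + a * ⟪ v , z ⟫                                   ≈⟨ rearrange ⟪ y , z ⟫ a ⟪ v , z ⟫ ⟪ p , z ⟫ ⟩
      (⟪ y , z ⟫ + a * ⟪ p , z ⟫) + a * (⟪ v , z ⟫ - ⟪ p , z ⟫)   ≈⟨ +-cong (⟪⟫-⊕ y a p z) (*-congˡ (⟪r,⟫ z)) ⟨
      ⟪ y ⊕[ a ] p , z ⟫ + a * ⟪ r , z ⟫                          ∎
      where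
      rearrange : ∀ y a v p → y + a * v ≈ (y + a * p) + a * (v - p)
      rearrange = solve 4 (λ y a v p → y :+ a :* v := (y :+ a :* p) :+ a :* (v :- p)) refl

    recompose : ∀ x y a → Decomposes x y a → Span (v ∷ vs) x
    recompose x y a (y∈ , x≈) = y ⊕[ - a ] p , a , Span-⊕ vs (- a) y∈ (proj₁ isProj) , λ z → begin-equality
      ⟪ x , z ⟫                                         ≈⟨ x≈ z ⟩
      ⟪ y , z ⟫ + a * ⟪ r , z ⟫                         ≈⟨ +-congˡ (*-congˡ (⟪r,⟫ z)) ⟩
      ⟪ y , z ⟫ + a * (⟪ v , z ⟫ - ⟪ p , z ⟫)           ≈⟨ rearrange ⟪ y , z ⟫ a ⟪ v , z ⟫ ⟪ p , z ⟫ ⟩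
      (⟪ y , z ⟫ + - a * ⟪ p , z ⟫) + a * ⟪ v , z ⟫     ≈⟨ +-congʳ (⟪⟫-⊕ y (- a) p z) ⟨
      ⟪ y ⊕[ - a ] p , z ⟫ + a * ⟪ v , z ⟫              ∎
      where
      rearrange : ∀ y a v p → y + a * (v - p) ≈ (y + - a * p) + a * v
      rearrange = solve 4 (λ y a v p → y :+ a :* (v :- p) := (y :+ :- a :* p) :+ a :* v) refl

    pythagoras : ∀ x y a x′ y′ a′ → Decomposes x y a → Decomposes x′ y′ a′ →
                 ⟪ x , x′ ⟫ ≈ ⟪ y , y′ ⟫ + a * a′ * N
    pythagoras x y a x′ y′ a′ (y∈ , x≈) (y′∈ , x′≈) = begin-equality
      ⟪ x , x′ ⟫                                                         ≈⟨ x≈ x′ ⟩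
      ⟪ y , x′ ⟫ + a * ⟪ r , x′ ⟫
        ≈⟨ +-cong (⟪⟫-sym y x′) (*-congˡ (⟪⟫-sym r x′)) ⟩
      ⟪ x′ , y ⟫ + a * ⟪ x′ , r ⟫                                        ≈⟨ +-cong (x′≈ y) (*-congˡ (x′≈ r)) ⟩
      (⟪ y′ , y ⟫ + a′ * ⟪ r , y ⟫) + a * (⟪ y′ , r ⟫ + a′ * N)
        ≈⟨ +-cong (+-cong (⟪⟫-sym y′ y) (*-congˡ (trans (⟪⟫-sym r y) (⟪y,r⟫≈0 y y∈))))
            (*-congˡ (+-congʳ (⟪y,r⟫≈0 y′ y′∈))) ⟩
      (⟪ y , y′ ⟫ + a′ * 0#) + a * (0# + a′ * N)                         ≈⟨ rearrange ⟪ y , y′ ⟫ a a′ N ⟩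
      ⟪ y , y′ ⟫ + a * a′ * N                                            ∎
      where
      rearrange : ∀ y a b n → (y + b * 0#) + a * (0# + b * n) ≈ y + a * b * n
      rearrange = solve 4 (λ y a b n → (y :+ b :* con (0 , 0)) :+ a :* (con (0 , 0) :+ b :* n) := y :+ a :* b :* n) refl

    -- β is the coefficient of z along r. When N vanishes, r is orthogonal to everything and any β
    -- would do, so 0 is taken.
    ratio : ∀ z → ∃ λ β → ⟪ r , z ⟫ ≈ β * N
    ratio z with em {N ≈ 0#}
    ... | yes N≈0 = 0# , trans (definite r N≈0 z) (sym (zeroˡ N))
    ... | no  N≉0 = let N⁻¹ , NN⁻¹≈1 = inverse N N≉0 in ⟪ r , z ⟫ * N⁻¹ , (begin-equality
      ⟪ r , z ⟫               ≈⟨ *-identityʳ _ ⟨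
      ⟪ r , z ⟫ * 1#          ≈⟨ *-congˡ NN⁻¹≈1 ⟨
      ⟪ r , z ⟫ * (N * N⁻¹)   ≈⟨ *-congˡ (*-comm N N⁻¹) ⟩
      ⟪ r , z ⟫ * (N⁻¹ * N)   ≈⟨ *-assoc _ N⁻¹ N ⟨
      ⟪ r , z ⟫ * N⁻¹ * N     ∎)

    -- As r is orthogonal to the span of `vs`, the projections onto the two summands add up: q + βr.
    projection-∷ : ∀ z q → IsProjection vs z q → ∃ (IsProjection (v ∷ vs) z)
    projection-∷ z q (q∈ , q≈) = q′ , recompose q′ q β dec′ , λ x x∈ →
      let y , a , y∈ , x≈ = decompose x x∈ in begin-equality
      ⟪ x , z ⟫                   ≈⟨ x≈ z ⟩
      ⟪ y , z ⟫ + a * ⟪ r , z ⟫   ≈⟨ +-cong (q≈ y y∈) (*-congˡ (proj₂ (ratio z))) ⟩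
      ⟪ y , q ⟫ + a * (β * N)     ≈⟨ +-congˡ (*-assoc a β N) ⟨
      ⟪ y , q ⟫ + a * β * N       ≈⟨ pythagoras x y a q′ q β (y∈ , x≈) dec′ ⟨
      ⟪ x , q′ ⟫                  ∎
      where
      β = proj₁ (ratio z)
      q′ = q ⊕[ β ] r
      dec′ : Decomposes q′ q β
      dec′ = q∈ , ⟪⟫-⊕ q β r

    dist²-decomposes : ∀ x y a x′ y′ a′ → Decomposes x y a → Decomposes x′ y′ a′ →
                       dist² x x′ ≈ dist² y y′ + (a - a′) * (a - a′) * N
    dist²-decomposes x y a x′ y′ a′ d d′ = trans
      (+-cong (+-cong (pythagoras x y a x y a d d) (pythagoras x′ y′ a′ x′ y′ a′ d′ d′))
              (-‿cong (+-cong (pythagoras x y a x′ y′ a′ d d′) (pythagoras x y a x′ y′ a′ d d′))))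
      (rearrange ⟪ y , y ⟫ ⟪ y′ , y′ ⟫ ⟪ y , y′ ⟫ a a′ N)
      where
      rearrange : ∀ s t u a b n → ((s + a * a * n) + (t + b * b * n)) - ((u + a * b * n) + (u + a * b * n))
                  ≈ ((s + t) - (u + u)) + (a - b) * (a - b) * n
      rearrange = solve 6 (λ s t u a b n →
        ((s :+ a :* a :* n) :+ (t :+ b :* b :* n)) :- ((u :+ a :* b :* n) :+ (u :+ a :* b :* n))
        := ((s :+ t) :- (u :+ u)) :+ (a :- b) :* (a :- b) :* n) refl

  projection : ∀ vs z → ∃ (IsProjection vs z)
  -- z - z serves as the zero vector.
  projection [] z = z ⊕[ - 1# ] z
    , (λ w → trans (⟪⟫-⊕ z (- 1#) z w) (solve 1 (λ a → a :+ (:- con (1 , 0)) :* a := con (0 , 0)) refl ⟪ z , w ⟫))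
    , λ x x≈0 → trans (x≈0 z) (sym (x≈0 _))
  projection (v ∷ vs) z = let p , isProj = projection vs v ; q , isProj′ = projection vs z in
    Residual.projection-∷ vs v p isProj z q isProj′

  -- By Pythagoras, a point of the ball splits into a point of a ball in the span of `vs` and a
  -- bounded coordinate along r. Squared distances add in the same way, so each factor is covered at
  -- scale ε / 2 and the cells are products.
  ball-cover : ∀ vs {B ε} → 0# ≤ B → 0# < ε →
    Cover (λ x → Span vs x × ⟪ x , x ⟫ ≤ B) (λ x y → dist² x y ≤ ε)
  ball-cover [] 0≤B 0<ε = record
    { size   = 1
    ; Cell   = λ _ → Span []
    ; covers = λ x (x≈0 , _) → zero , x≈0
    ; small  = λ _ x y x≈0 y≈0 → ≤-trans (≤-reflexive (trans
        (+-cong (+-cong (x≈0 x) (y≈0 y)) (-‿cong (+-cong (x≈0 y) (x≈0 y))))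
        (-‿inverseʳ (0# + 0#)))) (proj₁ 0<ε)
    }
  ball-cover (v ∷ vs) {B} {ε} 0≤B 0<ε = record
    { size   = C₁.size ℕ.* C₂.size
    ; Cell   = λ m x → Cell (remQuot C₂.size m) x
    ; covers = λ x (x∈ , x²≤B) →
        let y , a , d = decompose x x∈
            B-bound : ⟪ y , y ⟫ + a * a * N ≤ B
            B-bound = ≤-respˡ-≈ (pythagoras x y a x y a d d) x²≤B
            i , a∈i = C₁.covers a (≤-trans (≤-respʳ-≈ (+-comm _ _) (x≤x+y (nonNeg y))) B-bound)
            j , y∈j = C₂.covers y (proj₁ d , ≤-trans (x≤x+y (*-nonNeg (x²-nonNeg a) (nonNeg r))) B-bound)
        in combine i j , ≡.subst (λ k → Cell k x) (≡.sym (remQuot-combine i j)) (y , a , d , a∈i , y∈j)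
    ; small  = λ m x x′ (y , a , d , a∈ , y∈) (y′ , a′ , d′ , a′∈ , y′∈) → begin
        dist² x x′                                ≈⟨ dist²-decomposes x y a x′ y′ a′ d d′ ⟩
        dist² y y′ + (a - a′) * (a - a′) * N
          ≤⟨ +-mono-≤ (C₂.small _ y y′ y∈ y′∈) (C₁.small _ a a′ a∈ a′∈) ⟩
        η + η                                     ≈⟨ proj₂ (proj₂ (half 0<ε)) ⟨
        ε                                         ∎
    }
    where
    open Residual vs v (proj₁ (projection vs v)) (proj₂ (projection vs v))
    η = proj₁ (half 0<ε)
    0<η = proj₁ (proj₂ (half 0<ε))
    module C₁ = Cover (scaled-cover (nonNeg r) 0≤B 0<η)
    module C₂ = Cover (ball-cover vs 0≤B 0<η)
    -- Any decomposition of x may witness membership: for N = 0 the coordinate a is not determined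
    -- by x.
    Cell : Fin C₁.size × Fin C₂.size → Pred Vec 0ℓ
    Cell (i , j) x = ∃ λ y → ∃ λ a → Decomposes x y a × C₁.Cell i a × C₂.Cell j y

  -- To be used with p = ψ and q = iψ, a real orthonormal basis of the complex line of ψ. The
  -- squared length of the projection onto that plane is |⟨ψ|x⟩|².
  module OrthonormalPair (p q : Vec) (p-unit : ⟪ p , p ⟫ ≈ 1#) (q-unit : ⟪ q , q ⟫ ≈ 1#)
                         (p⊥q : ⟪ p , q ⟫ ≈ 0#) where

    fidelity : Vec → Carrier
    fidelity x = ⟪ p , x ⟫ * ⟪ p , x ⟫ + ⟪ q , x ⟫ * ⟪ q , x ⟫

    -- The difference of the two sides is the squared length of z, what remains of x after its
    -- projection onto the plane of p and q is removed.
    bessel : ∀ x → fidelity x ≤ ⟪ x , x ⟫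
    bessel x = 0≤y-x⇒x≤y (≤-respʳ-≈ zz≈ (nonNeg z))
      where
      α = ⟪ p , x ⟫
      β = ⟪ q , x ⟫
      z = x ⊕[ - α ] p ⊕[ - β ] q
      ⟪z,⟫ : ∀ w → ⟪ z , w ⟫ ≈ ⟪ x , w ⟫ + - α * ⟪ p , w ⟫ + - β * ⟪ q , w ⟫
      ⟪z,⟫ w = trans (⟪⟫-⊕ _ (- β) q w) (+-congʳ (⟪⟫-⊕ x (- α) p w))
      ⟪p,z⟫≈0 : ⟪ p , z ⟫ ≈ 0#
      ⟪p,z⟫≈0 = begin-equality
        ⟪ p , z ⟫                                            ≈⟨ ⟪⟫-sym p z ⟩
        ⟪ z , p ⟫                                            ≈⟨ ⟪z,⟫ p ⟩
        ⟪ x , p ⟫ + - α * ⟪ p , p ⟫ + - β * ⟪ q , p ⟫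
          ≈⟨ +-cong (+-cong (⟪⟫-sym x p) (*-congˡ p-unit)) (*-congˡ (trans (⟪⟫-sym q p) p⊥q)) ⟩
        α + - α * 1# + - β * 0#
          ≈⟨ solve 2 (λ a b → a :+ :- a :* con (1 , 0) :+ :- b :* con (0 , 0) := con (0 , 0)) refl α β ⟩
        0#                                                   ∎
      ⟪q,z⟫≈0 : ⟪ q , z ⟫ ≈ 0#
      ⟪q,z⟫≈0 = begin-equality
        ⟪ q , z ⟫                                            ≈⟨ ⟪⟫-sym q z ⟩
        ⟪ z , q ⟫                                            ≈⟨ ⟪z,⟫ q ⟩
        ⟪ x , q ⟫ + - α * ⟪ p , q ⟫ + - β * ⟪ q , q ⟫
          ≈⟨ +-cong (+-cong (⟪⟫-sym x q) (*-congˡ p⊥q)) (*-congˡ q-unit) ⟩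
        β + - α * 0# + - β * 1#
          ≈⟨ solve 2 (λ a b → b :+ :- a :* con (0 , 0) :+ :- b :* con (1 , 0) := con (0 , 0)) refl α β ⟩
        0#                                                   ∎
      zz≈ : ⟪ z , z ⟫ ≈ ⟪ x , x ⟫ - fidelity x
      zz≈ = begin-equality
        ⟪ z , z ⟫                                            ≈⟨ ⟪z,⟫ z ⟩
        ⟪ x , z ⟫ + - α * ⟪ p , z ⟫ + - β * ⟪ q , z ⟫
          ≈⟨ +-cong (+-cong (trans (⟪⟫-sym x z) (⟪z,⟫ x)) (*-congˡ ⟪p,z⟫≈0)) (*-congˡ ⟪q,z⟫≈0) ⟩
        (⟪ x , x ⟫ + - α * α + - β * β) + - α * 0# + - β * 0#
          ≈⟨ solve 3 (λ x a b → (x :+ :- a :* a :+ :- b :* b) :+ :- a :* con (0 , 0) :+ :- b :* con (0 , 0) := x :- (a :* a :+ b :* b))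
              refl ⟪ x , x ⟫ α β ⟩
        ⟪ x , x ⟫ - fidelity x                               ∎

    -- With d = b − a, t times (right-hand side − left-hand side) is
    -- (t⟨p,a⟩ + ⟨p,d⟩)² + (t⟨q,a⟩ + ⟨q,d⟩)² plus nonnegative slack.
    fidelity-continuous : ∀ {a b t δ} → 0# < t → ⟪ a , a ⟫ ≈ 1# → dist² a b ≤ t * t →
                          δ ≤ fidelity a → δ - (t + t) ≤ fidelity b
    fidelity-continuous {a} {b} {t} {δ} 0<t a-unit dist≤t² δ≤fa = *-cancelˡ-≤ 0<t (0≤y-x⇒x≤y (begin
      0#
        ≤⟨ +-nonNeg (+-nonNeg (+-nonNeg (+-nonNeg (x²-nonNeg (t * pa + pd)) (x²-nonNeg (t * qa + qd)))
             (*-nonNeg 0≤t (+-nonNeg (x²-nonNeg pd) (x²-nonNeg qd))))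
             (*-nonNeg 0≤t (x≤y⇒0≤y-x δ≤fa)))
             (+-nonNeg (*-nonNeg (x²-nonNeg t) (x≤y⇒0≤y-x (≤-respʳ-≈ a-unit (bessel a)))) (x≤y⇒0≤y-x fd≤t²)) ⟩
      ((t * pa + pd) * (t * pa + pd) + (t * qa + qd) * (t * qa + qd)
        + t * (pd * pd + qd * qd) + t * ((pa * pa + qa * qa) - δ))
        + (t * t * (1# - (pa * pa + qa * qa)) + (t * t - (pd * pd + qd * qd)))
        ≈⟨ rearrange t δ pa qa pd qd ⟩
      t * ((pa + pd) * (pa + pd) + (qa + qd) * (qa + qd)) - t * (δ - (t + t))
        ≈⟨ +-congʳ (*-congˡ (+-cong (*-cong (shift p) (shift p)) (*-cong (shift q) (shift q)))) ⟨
      t * fidelity b - t * (δ - (t + t)) ∎))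
      where
      d  = b ⊕[ - 1# ] a
      pa = ⟪ p , a ⟫
      qa = ⟪ q , a ⟫
      pd = ⟪ p , d ⟫
      qd = ⟪ q , d ⟫
      0≤t = proj₁ 0<t
      ⟪d,⟫ : ∀ w → ⟪ d , w ⟫ ≈ ⟪ b , w ⟫ - ⟪ a , w ⟫
      ⟪d,⟫ w = trans (⟪⟫-⊕ b (- 1#) a w)
        (solve 2 (λ a b → a :+ (:- con (1 , 0)) :* b := a :- b) refl ⟪ b , w ⟫ ⟪ a , w ⟫)
      shift : ∀ w → ⟪ w , b ⟫ ≈ ⟪ w , a ⟫ + ⟪ w , d ⟫
      shift w = begin-equality
        ⟪ w , b ⟫                             ≈⟨ solve 2 (λ a b → b := a :+ (b :- a)) refl ⟪ w , a ⟫ ⟪ w , b ⟫ ⟩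
        ⟪ w , a ⟫ + (⟪ w , b ⟫ - ⟪ w , a ⟫)   ≈⟨ +-congˡ (+-cong (⟪⟫-sym w b) (-‿cong (⟪⟫-sym w a))) ⟩
        ⟪ w , a ⟫ + (⟪ b , w ⟫ - ⟪ a , w ⟫)   ≈⟨ +-congˡ (⟪d,⟫ w) ⟨
        ⟪ w , a ⟫ + ⟪ d , w ⟫                 ≈⟨ +-congˡ (⟪⟫-sym d w) ⟩
        ⟪ w , a ⟫ + ⟪ w , d ⟫                 ∎
      dd≈dist² : ⟪ d , d ⟫ ≈ dist² a b
      dd≈dist² = begin-equality
        ⟪ d , d ⟫                                                          ≈⟨ ⟪d,⟫ d ⟩
        ⟪ b , d ⟫ - ⟪ a , d ⟫
          ≈⟨ +-cong (trans (⟪⟫-sym b d) (⟪d,⟫ b)) (-‿cong (trans (⟪⟫-sym a d) (⟪d,⟫ a))) ⟩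
        (⟪ b , b ⟫ - ⟪ a , b ⟫) - (⟪ b , a ⟫ - ⟪ a , a ⟫)
          ≈⟨ +-congˡ (-‿cong (+-congʳ (⟪⟫-sym b a))) ⟩
        (⟪ b , b ⟫ - ⟪ a , b ⟫) - (⟪ a , b ⟫ - ⟪ a , a ⟫)
          ≈⟨ solve 3 (λ bb ab aa → (bb :- ab) :- (ab :- aa) := (aa :+ bb) :- (ab :+ ab))
              refl ⟪ b , b ⟫ ⟪ a , b ⟫ ⟪ a , a ⟫ ⟩
        dist² a b                                                          ∎
      fd≤t² : fidelity d ≤ t * t
      fd≤t² = ≤-trans (bessel d) (≤-respˡ-≈ (sym dd≈dist²) dist≤t²)
      rearrange : ∀ t δ pa qa pd qd →
        ((t * pa + pd) * (t * pa + pd) + (t * qa + qd) * (t * qa + qd)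
          + t * (pd * pd + qd * qd) + t * ((pa * pa + qa * qa) - δ))
          + (t * t * (1# - (pa * pa + qa * qa)) + (t * t - (pd * pd + qd * qd)))
        ≈ t * ((pa + pd) * (pa + pd) + (qa + qd) * (qa + qd)) - t * (δ - (t + t))
      rearrange = solve 6 (λ t δ pa qa pd qd →
        ((t :* pa :+ pd) :* (t :* pa :+ pd) :+ (t :* qa :+ qd) :* (t :* qa :+ qd)
          :+ t :* (pd :* pd :+ qd :* qd) :+ t :* ((pa :* pa :+ qa :* qa) :- δ))
          :+ (t :* t :* (con (1 , 0) :- (pa :* pa :+ qa :* qa)) :+ (t :* t :- (pd :* pd :+ qd :* qd)))
        := t :* ((pa :+ pd) :* (pa :+ pd) :+ (qa :+ qd) :* (qa :+ qd)) :- t :* (δ :- (t :+ t))) refl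

^-+ : {A : Set} (w : List A) (m n : ℕ) → w ^ (m ℕ.+ n) ≡ w ^ m ++ w ^ n
^-+ w zero    n = ≡.refl
^-+ w (suc m) n = ≡.trans (≡.cong (w ++_) (^-+ w m n)) (≡.sym (++-assoc w (w ^ m) (w ^ n)))

-- The Hilbert space as a real inner product space

module HilbertProperties (em : ExcludedMiddle 0ℓ) (ℝ : CompleteOrderedField)
                         (H : HilbertSpaces.FiniteDimensionalHilbertSpace ℝ) where
  open CompleteOrderedField ℝ renaming (zero to *-zero)
  open OrderedField em ℝ
  open HilbertSpaces ℝ using (ℂ; _+i_; re; im; ∣_∣²)
  open HilbertSpaces.FiniteDimensionalHilbertSpace H
    using (Carrierᴹ; _+ᴹ_; _*ₗ_; _≈ᴹ_; 0ᴹ; ≈ᴹ-refl; +ᴹ-rawMonoid; ⟨_∣_⟩; ⟨∣⟩-cong; ⟨∣⟩-conj-sym; ⟨∣⟩-+ʳ; ⟨∣⟩-*ʳ;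
           ⟨∣⟩-nonNegative; ⟨∣⟩-definite; finiteDimensional; IsUnit; +ᴹ-identityʳ)

  x≈-x⇒x≈0 : ∀ {x} → x ≈ - x → x ≈ 0#
  x≈-x⇒x≈0 {x} x≈-x with total 0# x
  ... | inj₁ 0≤x = antisym (≤-respʳ-≈ (trans (+-congˡ x≈-x) (-‿inverseʳ x)) (x≤x+y 0≤x)) 0≤x
  ... | inj₂ x≤0 = antisym x≤0 (≤-respˡ-≈ (trans (+-congˡ x≈-x) (-‿inverseʳ x))
                     (≤-respʳ-≈ (+-identityʳ x) (+-monoʳ-≤ x x≤0)))

  im⟨x∣x⟩≈0 : ∀ x → im ⟨ x ∣ x ⟩ ≈ 0#
  im⟨x∣x⟩≈0 x = x≈-x⇒x≈0 (proj₂ (⟨∣⟩-conj-sym x x))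

  -- H is viewed as a real inner product space; multiplication by i, J below, recovers the imaginary part.
  ⟪_,_⟫ : Carrierᴹ → Carrierᴹ → Carrier
  ⟪ x , y ⟫ = re ⟨ x ∣ y ⟩

  ⟪⟫-sym : ∀ x y → ⟪ x , y ⟫ ≈ ⟪ y , x ⟫
  ⟪⟫-sym x y = proj₁ (⟨∣⟩-conj-sym x y)

  ⟪⟫-cong : ∀ {x x′} y → x ≈ᴹ x′ → ⟪ x , y ⟫ ≈ ⟪ x′ , y ⟫
  ⟪⟫-cong y x≈x′ = proj₁ (⟨∣⟩-cong x≈x′ ≈ᴹ-refl)

  ⟪⟫-+ : ∀ x y z → ⟪ x +ᴹ y , z ⟫ ≈ ⟪ x , z ⟫ + ⟪ y , z ⟫
  ⟪⟫-+ x y z = begin-equality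
    ⟪ x +ᴹ y , z ⟫        ≈⟨ ⟪⟫-sym (x +ᴹ y) z ⟩
    ⟪ z , x +ᴹ y ⟫        ≈⟨ proj₁ (⟨∣⟩-+ʳ z x y) ⟩
    ⟪ z , x ⟫ + ⟪ z , y ⟫ ≈⟨ +-cong (⟪⟫-sym z x) (⟪⟫-sym z y) ⟩
    ⟪ x , z ⟫ + ⟪ y , z ⟫ ∎

  J : Carrierᴹ → Carrierᴹ
  J x = (0# +i 1#) *ₗ x

  ⟪J,⟫ : ∀ x y → ⟪ J x , y ⟫ ≈ im ⟨ x ∣ y ⟩
  ⟪J,⟫ x y = begin-equality
    ⟪ J x , y ⟫                                 ≈⟨ ⟪⟫-sym (J x) y ⟩
    ⟪ y , J x ⟫                                 ≈⟨ proj₁ (⟨∣⟩-*ʳ y (0# +i 1#) x) ⟩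
    0# * re ⟨ y ∣ x ⟩ - 1# * im ⟨ y ∣ x ⟩
      ≈⟨ solve 2 (λ a b → con (0 , 0) :* a :- con (1 , 0) :* b := :- b) refl _ _ ⟩
    - im ⟨ y ∣ x ⟩                              ≈⟨ proj₂ (⟨∣⟩-conj-sym x y) ⟨
    im ⟨ x ∣ y ⟩                                ∎

  ⟪⟫-* : ∀ a b x z → ⟪ (a +i b) *ₗ x , z ⟫ ≈ a * ⟪ x , z ⟫ + b * ⟪ J x , z ⟫
  ⟪⟫-* a b x z = begin-equality
    ⟪ (a +i b) *ₗ x , z ⟫                       ≈⟨ ⟪⟫-sym _ z ⟩
    ⟪ z , (a +i b) *ₗ x ⟫                       ≈⟨ proj₁ (⟨∣⟩-*ʳ z (a +i b) x) ⟩
    a * re ⟨ z ∣ x ⟩ - b * im ⟨ z ∣ x ⟩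
      ≈⟨ solve 4 (λ a b c d → a :* c :- b :* d := a :* c :+ b :* (:- d)) refl a b _ _ ⟩
    a * re ⟨ z ∣ x ⟩ + b * - im ⟨ z ∣ x ⟩
      ≈⟨ +-cong (*-congˡ (⟪⟫-sym x z)) (*-congˡ (proj₂ (⟨∣⟩-conj-sym x z))) ⟨
    a * ⟪ x , z ⟫ + b * im ⟨ x ∣ z ⟩            ≈⟨ +-congˡ (*-congˡ (⟪J,⟫ x z)) ⟨
    a * ⟪ x , z ⟫ + b * ⟪ J x , z ⟫             ∎

  ⟪0,⟫ : ∀ z → ⟪ 0ᴹ , z ⟫ ≈ 0#
  ⟪0,⟫ z = begin-equality
    ⟪ 0ᴹ , z ⟫                                  ≈⟨ solve 1 (λ a → a := (a :+ a) :- a) refl _ ⟩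
    (⟪ 0ᴹ , z ⟫ + ⟪ 0ᴹ , z ⟫) - ⟪ 0ᴹ , z ⟫      ≈⟨ +-congʳ (⟪⟫-+ 0ᴹ 0ᴹ z) ⟨
    ⟪ 0ᴹ +ᴹ 0ᴹ , z ⟫ - ⟪ 0ᴹ , z ⟫               ≈⟨ +-congʳ (⟪⟫-cong z (+ᴹ-identityʳ 0ᴹ)) ⟩
    ⟪ 0ᴹ , z ⟫ - ⟪ 0ᴹ , z ⟫                     ≈⟨ -‿inverseʳ _ ⟩
    0#                                          ∎

  realSpace : RealInnerProductSpace ℝ
  realSpace = record
    { Vec      = Carrierᴹ
    ; ⟪_,_⟫    = ⟪_,_⟫
    ; ⟪⟫-sym   = ⟪⟫-sym
    ; _⊕[_]_   = λ x a y → x +ᴹ (a +i 0#) *ₗ y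
    ; ⟪⟫-⊕     = λ x a y z → trans (⟪⟫-+ x _ z) (+-congˡ (trans (⟪⟫-* a 0# y z)
                   (trans (+-congˡ (zeroˡ _)) (+-identityʳ _))))
    ; nonNeg   = ⟨∣⟩-nonNegative
    ; definite = λ x ⟪x,x⟫≈0 y → trans (⟪⟫-cong y (⟨∣⟩-definite x (⟪x,x⟫≈0 , im⟨x∣x⟩≈0 x))) (⟪0,⟫ y)
    }

  open InnerProduct em ℝ realSpace public
  open RealInnerProductSpace realSpace using (_⊕[_]_; ⟪⟫-⊕)

  -- A coefficient a + bi acts on e as a times e plus b times `J e`, so each complex generator
  -- yields two real ones.
  generators : ∀ d → Vector Carrierᴹ d → List Carrierᴹ
  generators zero    e = []
  generators (suc d) e = e zero ∷ J (e zero) ∷ generators d (e ∘ suc)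

  sum∈Span : ∀ d e (c : Vector ℂ d) → Span (generators d e) (sum +ᴹ-rawMonoid (λ i → c i *ₗ e i))
  sum∈Span zero    e c = ⟪0,⟫
  sum∈Span (suc d) e c = rest ⊕[ im c₀ ] J e₀ , re c₀
    , (rest , im c₀ , sum∈Span d (e ∘ suc) (c ∘ suc) , ⟪⟫-⊕ rest (im c₀) (J e₀))
    , λ z → begin-equality
      ⟪ c₀ *ₗ e₀ +ᴹ rest , z ⟫                                            ≈⟨ ⟪⟫-+ _ rest z ⟩
      ⟪ c₀ *ₗ e₀ , z ⟫ + ⟪ rest , z ⟫
        ≈⟨ +-congʳ (⟪⟫-* (re c₀) (im c₀) e₀ z) ⟩
      (re c₀ * ⟪ e₀ , z ⟫ + im c₀ * ⟪ J e₀ , z ⟫) + ⟪ rest , z ⟫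
        ≈⟨ solve 3 (λ a b c → (a :+ b) :+ c := (c :+ b) :+ a) refl _ _ _ ⟩
      (⟪ rest , z ⟫ + im c₀ * ⟪ J e₀ , z ⟫) + re c₀ * ⟪ e₀ , z ⟫
        ≈⟨ +-congʳ (⟪⟫-⊕ rest (im c₀) (J e₀) z) ⟨
      ⟪ rest ⊕[ im c₀ ] J e₀ , z ⟫ + re c₀ * ⟪ e₀ , z ⟫                   ∎
    where
    e₀ = e zero
    c₀ = c zero
    rest = sum +ᴹ-rawMonoid (λ i → c (suc i) *ₗ e (suc i))

  Span-resp : ∀ vs {x y} → (∀ z → ⟪ x , z ⟫ ≈ ⟪ y , z ⟫) → Span vs y → Span vs x
  Span-resp []       x≈y y≈0              z = trans (x≈y z) (y≈0 z)
  Span-resp (_ ∷ _)  x≈y (y′ , a , y′∈ , y≈) = y′ , a , y′∈ , λ z → trans (x≈y z) (y≈ z)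

  basis : List Carrierᴹ
  basis = let d , e , _ = finiteDimensional in generators d e

  ∈Span-basis : ∀ x → Span basis x
  ∈Span-basis x = let d , e , spans = finiteDimensional ; c , x≈ = spans x in
    Span-resp (generators d e) (λ z → ⟪⟫-cong z x≈) (sum∈Span d e c)

  module UnitVector (ψ : Carrierᴹ) (ψ-unit : IsUnit ψ) where

    open OrthonormalPair ψ (J ψ) (proj₁ ψ-unit)
      (begin-equality
        ⟪ J ψ , J ψ ⟫                             ≈⟨ ⟪J,⟫ ψ (J ψ) ⟩
        im ⟨ ψ ∣ J ψ ⟩                            ≈⟨ proj₂ (⟨∣⟩-*ʳ ψ (0# +i 1#) ψ) ⟩
        0# * im ⟨ ψ ∣ ψ ⟩ + 1# * re ⟨ ψ ∣ ψ ⟩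
          ≈⟨ solve 2 (λ a b → con (0 , 0) :* a :+ con (1 , 0) :* b := b) refl _ _ ⟩
        re ⟨ ψ ∣ ψ ⟩                              ≈⟨ proj₁ ψ-unit ⟩
        1#                                        ∎)
      (trans (⟪⟫-sym ψ (J ψ)) (trans (⟪J,⟫ ψ ψ) (proj₂ ψ-unit)))
      public

    fidelity≈∣∣² : ∀ x → fidelity x ≈ ∣ ⟨ ψ ∣ x ⟩ ∣²
    fidelity≈∣∣² x = +-congˡ (*-cong (⟪J,⟫ ψ x) (⟪J,⟫ ψ x))

    fidelity-ψ : fidelity ψ ≈ 1#
    fidelity-ψ = begin-equality
      fidelity ψ                     ≈⟨ fidelity≈∣∣² ψ ⟩
      ∣ ⟨ ψ ∣ ψ ⟩ ∣²
        ≈⟨ +-cong (*-cong (proj₁ ψ-unit) (proj₁ ψ-unit)) (*-cong (proj₂ ψ-unit) (proj₂ ψ-unit)) ⟩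
      1# * 1# + 0# * 0#
        ≈⟨ solve 0 (con (1 , 0) :* con (1 , 0) :+ con (0 , 0) :* con (0 , 0) := con (1 , 0)) refl ⟩
      1#                             ∎

-- Unitary evolution and recurrence

module Evolution (em : ExcludedMiddle 0ℓ) (ℝ : CompleteOrderedField) {A : Set}
                 (𝒜 : QuantumAutomata.QuantumAutomaton em ℝ A) where
  open CompleteOrderedField ℝ renaming (zero to *-zero)
  open OrderedField em ℝ
  open QuantumAutomata em ℝ
  open QuantumAutomaton 𝒜 using (H; U; Carrierᴹ; ⟨_∣_⟩; ⟨∣⟩-cong; ≈ᴹ-refl; IsUnit)
  open HilbertProperties em ℝ H
  open UnitaryOperator using (⟦_⟧; adjoint; U†U≈I)

  T : List A → Carrierᴹ → Carrierᴹ
  T []      x = x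
  T (a ∷ u) x = T u (⟦ U a ⟧ x)

  T-++ : ∀ u v x → T (u ++ v) x ≡ T v (T u x)
  T-++ []      v x = ≡.refl
  T-++ (a ∷ u) v x = T-++ u v (⟦ U a ⟧ x)

  T-isometry : ∀ u x y → ⟨ T u x ∣ T u y ⟩ ℂ-Ring.≈ ⟨ x ∣ y ⟩
  T-isometry []      x y = ℂ-Ring.refl
  T-isometry (a ∷ u) x y = ℂ-Ring.trans (T-isometry u _ _)
    (ℂ-Ring.trans (ℂ-Ring.sym (adjoint (U a) _ y)) (⟨∣⟩-cong (U†U≈I (U a) x) ≈ᴹ-refl))

  T-unit : ∀ u {x} → IsUnit x → IsUnit (T u x)
  T-unit u {x} = ℂ-Ring.trans (T-isometry u x x)

  T-dist² : ∀ u x y → dist² (T u x) (T u y) ≈ dist² x y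
  T-dist² u x y = +-cong (+-cong (iso x x) (iso y y)) (-‿cong (+-cong (iso x y) (iso x y)))
    where
    iso : ∀ x y → ⟪ T u x , T u y ⟫ ≈ ⟪ x , y ⟫
    iso x y = proj₁ (T-isometry u x y)

  -- The bounded orbit of x under T (w ^ (1 + N)) visits some cell of a fine cover twice.
  recurrence : ∀ w {x} → IsUnit x → ∀ {ε} → 0# < ε → ∀ N → ∃ λ k → N ℕ.< k × dist² x (T (w ^ k) x) ≤ ε
  recurrence w {x} x-unit {ε} 0<ε N =
    let i , j , i<j , fi≡fj = pigeonhole (ℕ.n<1+n size) f
        k = (toℕ j ℕ.∸ toℕ i) ℕ.* suc N
        jM≡k+iM : toℕ j ℕ.* suc N ≡ k ℕ.+ toℕ i ℕ.* suc N
        jM≡k+iM = ≡.trans (≡.cong (ℕ._* suc N) (≡.sym (ℕ.m∸n+n≡m (ℕ.<⇒≤ i<j))))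
                    (ℕ.*-distribʳ-+ (suc N) (toℕ j ℕ.∸ toℕ i) (toℕ i))
        orbit-j : orbit j ≡ T (w ^ (toℕ i ℕ.* suc N)) (T (w ^ k) x)
        orbit-j = ≡.trans (≡.cong (λ n → T (w ^ n) x) jM≡k+iM)
                    (≡.trans (≡.cong (λ u → T u x) (^-+ w k (toℕ i ℕ.* suc N))) (T-++ (w ^ k) _ x))
    in k , ℕ.m≤n*m (suc N) (toℕ j ℕ.∸ toℕ i) {{ℕ.>-nonZero (ℕ.m<n⇒0<n∸m i<j)}} , (begin
      dist² x (T (w ^ k) x)         ≈⟨ T-dist² (w ^ (toℕ i ℕ.* suc N)) x (T (w ^ k) x) ⟨
      dist² (orbit i) (T (w ^ (toℕ i ℕ.* suc N)) (T (w ^ k) x)) ≡⟨ ≡.cong (dist² (orbit i)) orbit-j ⟨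
      dist² (orbit i) (orbit j)     ≤⟨ small (f i) (orbit i) (orbit j) (proj₂ (cell i))
                                         (≡.subst (λ m → Cell m (orbit j)) (≡.sym fi≡fj) (proj₂ (cell j))) ⟩
      ε                             ∎)
    where
    open Cover (ball-cover basis (proj₁ 0<1) 0<ε)
    orbit : Fin (suc size) → Carrierᴹ
    orbit i = T (w ^ (toℕ i ℕ.* suc N)) x
    cell : ∀ i → ∃ λ m → Cell m (orbit i)
    cell i = covers (orbit i) (∈Span-basis (orbit i) , ≤-reflexive (proj₁ (T-unit (w ^ (toℕ i ℕ.* suc N)) x-unit)))
    f : Fin (suc size) → Fin size
    f i = proj₁ (cell i)

  module _ (ψ : Carrierᴹ) (ψ-unit : IsUnit ψ) where
    open UnitVector ψ ψ-unit

    -- Recurrence at T(u)s with squared distance at most t² is carried past p by the isometry T(p).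
    -- The end states are then within t of each other, which costs at most 2t of fidelity. The start
    -- s is left general, since the first segment acts on `s₀` and all others on ψ.
    fidelity-pump : ∀ {s} → IsUnit s → ∀ u w p {t δ} → 0# < t → δ ≤ fidelity (T (u ++ p) s) →
      ∀ N → ∃ λ k → N ℕ.< k × δ - (t + t) ≤ fidelity (T (u ++ w ^ k ++ p) s)
    fidelity-pump {s} s-unit u w p {t} {δ} 0<t δ≤fid N =
      let k , N<k , close = recurrence w (T-unit u s-unit) (*-pos 0<t 0<t) N in
      k , N<k , (begin
        δ - (t + t)
          ≤⟨ fidelity-continuous 0<t (proj₁ (T-unit p (T-unit u s-unit)))
                                                          (≤-respˡ-≈ (sym (T-dist² p _ _)) close)
                                                          (≡.subst (λ x → δ ≤ fidelity x) (T-++ u p s) δ≤fid) ⟩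
        fidelity (T p (T (w ^ k) (T u s)))
          ≡⟨ ≡.cong fidelity (≡.trans (T-++ u (w ^ k ++ p) s) (T-++ (w ^ k) p (T u s))) ⟨
        fidelity (T (u ++ w ^ k ++ p) s)             ∎)

-- Infinite words and their segmentations

module _ {A : Set} where

  dropω : ℕ → A ^ω → A ^ω
  dropω m v n = v (m ℕ.+ n)

  ++ω-cong : ∀ u {v v′ : A ^ω} → v ≗ v′ → u ++ω v ≗ u ++ω v′
  ++ω-cong []      v≗v′ n       = v≗v′ n
  ++ω-cong (a ∷ u) v≗v′ zero    = ≡.refl
  ++ω-cong (a ∷ u) v≗v′ (suc n) = ++ω-cong u v≗v′ n

  ++ω-assoc : ∀ u v (z : A ^ω) → (u ++ v) ++ω z ≗ u ++ω (v ++ω z)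
  ++ω-assoc []      v z n       = ≡.refl
  ++ω-assoc (a ∷ u) v z zero    = ≡.refl
  ++ω-assoc (a ∷ u) v z (suc n) = ++ω-assoc u v z n

  -- Locates the end of u relative to a segment p: within p or at its end in the first case,
  -- strictly beyond it in the second.
  ++ω-compare : ∀ u p {v v′ : A ^ω} → u ++ω v ≗ p ++ω v′ →
    (∃ λ p′ → p ≡ u ++ p′ × v ≗ p′ ++ω v′) ⊎ (∃ λ u′ → u ≡ p ++ u′ × v′ ≗ u′ ++ω v)
  ++ω-compare []      p       eq = inj₁ (p , ≡.refl , eq)
  ++ω-compare (a ∷ u) []      eq = inj₂ (a ∷ u , ≡.refl , λ n → ≡.sym (eq n))
  ++ω-compare (a ∷ u) (b ∷ p) eq with eq zero | ++ω-compare u p (λ n → eq (suc n))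
  ... | ≡.refl | inj₁ (p′ , ≡.refl , eq′) = inj₁ (p′ , ≡.refl , eq′)
  ... | ≡.refl | inj₂ (u′ , ≡.refl , eq′) = inj₂ (u′ , ≡.refl , eq′)

  applyUpTo-++ω : ∀ n (v : A ^ω) → v ≗ applyUpTo v n ++ω dropω n v
  applyUpTo-++ω zero    v m       = ≡.refl
  applyUpTo-++ω (suc n) v zero    = ≡.refl
  applyUpTo-++ω (suc n) v (suc m) = applyUpTo-++ω n (λ i → v (suc i)) m

  applyUpTo-prefix : ∀ x {v z : A ^ω} → v ≗ x ++ω z → applyUpTo v (length x) ≡ x
  applyUpTo-prefix []      eq = ≡.refl
  applyUpTo-prefix (a ∷ x) eq = ≡.cong₂ _∷_ (eq zero) (applyUpTo-prefix x (λ n → eq (suc n)))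

  ++ω-lookup : ∀ u (v : A ^ω) n (n<u : n ℕ.< length u) → (u ++ω v) n ≡ lookup u (fromℕ< n<u)
  ++ω-lookup (a ∷ u) v zero    n<u       = ≡.refl
  ++ω-lookup (a ∷ u) v (suc n) (s≤s n<u) = ++ω-lookup u v n n<u

  ++ω-drop : ∀ u (v : A ^ω) n → (u ++ω v) (length u ℕ.+ n) ≡ v n
  ++ω-drop []      v n = ≡.refl
  ++ω-drop (a ∷ u) v n = ++ω-drop u v n

  repeat-unfold : ∀ (w : List⁺ A) → repeat w ≗ toList w ++ω repeat w
  repeat-unfold w@(a ∷ u) n with n ℕ.<? length (a ∷ u)
  ... | yes n<ℓ = ≡.trans
    (≡.cong (lookup (a ∷ u)) (fromℕ<-cong _ _ (m<n⇒m%n≡m n<ℓ) (m%n<n n (length (a ∷ u))) n<ℓ))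
    (≡.sym (++ω-lookup (a ∷ u) (repeat w) n n<ℓ))
  ... | no  n≮ℓ = ≡.trans
    (≡.cong (lookup (a ∷ u)) (fromℕ<-cong _ _ n%ℓ≡m%ℓ (m%n<n n ℓ) (m%n<n m ℓ)))
    (≡.trans (≡.sym (++ω-drop (a ∷ u) (repeat w) m)) (≡.cong ((a ∷ u) ++ω repeat w) (≡.sym n≡ℓ+m)))
    where
    ℓ = length (a ∷ u)
    m = n ℕ.∸ ℓ
    n≡ℓ+m : n ≡ ℓ ℕ.+ m
    n≡ℓ+m = ≡.sym (ℕ.m+[n∸m]≡n (ℕ.≮⇒≥ n≮ℓ))
    n%ℓ≡m%ℓ : n % ℓ ≡ m % ℓ
    n%ℓ≡m%ℓ = ≡.trans (≡.cong (_% ℓ) (≡.trans n≡ℓ+m (ℕ.+-comm ℓ m))) ([m+n]%n≡m%n m ℓ)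

  repeat-unfold-^ : ∀ (w : List⁺ A) k → repeat w ≗ (toList w ^ k) ++ω repeat w
  repeat-unfold-^ w zero    n = ≡.refl
  repeat-unfold-^ w (suc k) n = ≡.trans (repeat-unfold w n)
    (≡.trans (++ω-cong (toList w) (repeat-unfold-^ w k) n)
             (≡.sym (++ω-assoc (toList w) (toList w ^ k) (repeat w) n)))

  length-^ : ∀ (w : List⁺ A) k → k ℕ.≤ length (toList w ^ k)
  length-^ w       zero    = z≤n
  length-^ w@(a ∷ u) (suc k) = s≤s (ℕ.≤-trans (ℕ.≤-trans (length-^ w k) (ℕ.m≤n+m _ (length u)))
                                 (ℕ.≤-reflexive (≡.sym (length-++ u))))

  -- The factorisation is recorded through the suffix `rest i` at which each segment starts, which
  -- replaces an infinite concatenation. Nonemptiness of the segments mirrors strictly increasing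
  -- checkpoints.
  record Segmented (P : Pred (List A) 0ℓ) (v : A ^ω) : Set where
    field
      segment  : ℕ → List A
      rest     : ℕ → A ^ω
      begins   : v ≗ rest 0
      unfold   : ∀ i → rest i ≗ segment i ++ω rest (suc i)
      nonempty : ∀ i → 1 ℕ.≤ length (segment i)
      holds    : ∀ i → P (segment i)

  module _ {P : Pred (List A) 0ℓ} where
    open Segmented

    Segmented-resp : ∀ {v v′} → v ≗ v′ → Segmented P v′ → Segmented P v
    Segmented-resp v≗v′ S = record
      { Segmented S ; begins = λ n → ≡.trans (v≗v′ n) (begins S n) }

    Segmented-map : ∀ {Q : Pred (List A) 0ℓ} → P ⊆ Q → ∀ {v} → Segmented P v → Segmented Q v
    Segmented-map P⊆Q S = record
      { segment = segment S ; rest = rest S ; begins = begins S ; unfold = unfold S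
      ; nonempty = nonempty S ; holds = λ i → P⊆Q (holds S i) }

    Segmented-uncons : ∀ {v} → Segmented P v →
      ∃ λ p → ∃ λ v′ → v ≗ p ++ω v′ × 1 ℕ.≤ length p × P p × Segmented P v′
    Segmented-uncons S = segment S 0 , rest S 1
      , (λ n → ≡.trans (begins S n) (unfold S 0 n)) , nonempty S 0 , holds S 0 , record
      { segment  = λ i → segment S (suc i)
      ; rest     = λ i → rest S (suc i)
      ; begins   = λ _ → ≡.refl
      ; unfold   = λ i → unfold S (suc i)
      ; nonempty = λ i → nonempty S (suc i)
      ; holds    = λ i → holds S (suc i)
      }

    Segmented-cons : ∀ {v} p {v′} → v ≗ p ++ω v′ → 1 ℕ.≤ length p → P p → Segmented P v′ → Segmented P v
    Segmented-cons {v} p {v′} v≗ 1≤p Pp S = record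
      { segment  = λ { zero → p ; (suc i) → segment S i }
      ; rest     = λ { zero → v ; (suc i) → rest S i }
      ; begins   = λ _ → ≡.refl
      ; unfold   = λ { zero n → ≡.trans (v≗ n) (++ω-cong p (begins S) n) ; (suc i) → unfold S i }
      ; nonempty = λ { zero → 1≤p ; (suc i) → nonempty S i }
      ; holds    = λ { zero → Pp ; (suc i) → holds S i }
      }

    Segmented-periodic : ∀ {v} p → v ≗ p ++ω v → 1 ℕ.≤ length p → P p → Segmented P v
    Segmented-periodic {v} p v≗ 1≤p Pp = record
      { segment  = λ _ → p
      ; rest     = λ _ → v
      ; begins   = λ _ → ≡.refl
      ; unfold   = λ _ → v≗
      ; nonempty = λ _ → 1≤p
      ; holds    = λ _ → Pp
      }

    Segmented-concat : ∀ {xs v} → All (λ p → 1 ℕ.≤ length p × P p) xs →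
                       Segmented P v → Segmented P (concat xs ++ω v)
    Segmented-concat []                             S = S
    Segmented-concat {p ∷ xs} {v} ((1≤p , Pp) ∷ ps) S =
      Segmented-cons p (++ω-assoc p (concat xs) v) 1≤p Pp (Segmented-concat ps S)

    -- Taking off n segments suffices, since each contributes at least one letter.
    Segmented-split : ∀ n {v} → Segmented P v → ∃ λ xs → ∃ λ v′ →
      n ℕ.≤ length (concat xs) × v ≗ concat xs ++ω v′ × All (λ p → 1 ℕ.≤ length p × P p) xs × Segmented P v′
    Segmented-split zero    {v} S = [] , v , z≤n , (λ _ → ≡.refl) , [] , S
    Segmented-split (suc n) S =
      let p , v₁ , v≗ , 1≤p , Pp , S₁       = Segmented-uncons S
          xs , v₂ , n≤xs , v₁≗ , all , S₂ = Segmented-split n S₁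
      in p ∷ xs , v₂
       , ℕ.≤-trans (ℕ.+-mono-≤ 1≤p n≤xs) (ℕ.≤-reflexive (≡.sym (length-++ p)))
       , (λ m → ≡.trans (v≗ m) (≡.trans (++ω-cong p v₁≗ m) (≡.sym (++ω-assoc p (concat xs) v₂ m))))
       , (1≤p , Pp) ∷ all , S₂

-- The disturbing run between checkpoints

module Runs (em : ExcludedMiddle 0ℓ) (ℝ : CompleteOrderedField) {A : Set}
            (𝒜 : QuantumAutomata.QuantumAutomaton em ℝ A) where
  open QuantumAutomata em ℝ
  open QuantumAutomaton 𝒜 using (Carrierᴹ; U; s₀)
  open Evolution em ℝ 𝒜 using (T)
  open UnitaryOperator using (⟦_⟧)
  open Checkpoints

  at-mono : ∀ c {i j} → i ℕ.≤ j → at c i ℕ.≤ at c j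
  at-mono c {i} {j} i≤j with ℕ.m≤n⇒m<n∨m≡n i≤j
  ... | inj₁ i<j    = ℕ.<⇒≤ (increasing c i<j)
  ... | inj₂ ≡.refl = ℕ.≤-refl

  at-cancel-< : ∀ c {i j} → at c i ℕ.< at c j → i ℕ.< j
  at-cancel-< c ci<cj = ℕ.≰⇒> λ j≤i → ℕ.<⇒≱ ci<cj (at-mono c j≤i)

  module _ (w : A ^ω) (ψ : Carrierᴹ) (c : Checkpoints) where

    private
      run = disturbingRun 𝒜 w ψ c

      IsCheckpoint : Pred ℕ 0ℓ
      IsCheckpoint n = ∃ λ i → n ≡ at c i

    run-reset : ∀ {n} → IsCheckpoint n → run (suc n) ≡ ⟦ U (w n) ⟧ ψ
    run-reset {n} n∈c with em {∃ λ i → n ≡ at c i}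
    ... | yes _   = ≡.refl
    ... | no  n∉c = ⊥-elim (n∉c n∈c)

    run-step : ∀ {n} → ¬ IsCheckpoint n → run (suc n) ≡ ⟦ U (w n) ⟧ (run n)
    run-step {n} n∉c with em {∃ λ i → n ≡ at c i}
    ... | yes n∈c = ⊥-elim (n∉c n∈c)
    ... | no  _   = ≡.refl

    -- A checkpoint at n changes the state at n + 1. Hence the start a must not be a checkpoint,
    -- whereas the end a + |u| may be one.
    run-free : ∀ u {v} a → dropω a w ≗ u ++ω v →
      (∀ n → a ℕ.≤ n → n ℕ.< a ℕ.+ length u → ¬ IsCheckpoint n) → run (a ℕ.+ length u) ≡ T u (run a)
    run-free []      a w≗ free = ≡.cong run (ℕ.+-identityʳ a)
    run-free (x ∷ u) a w≗ free = ≡.trans (≡.cong run (ℕ.+-suc a (length u)))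
      (≡.trans (run-free u (suc a)
                 (λ n → ≡.trans (≡.cong w (≡.sym (ℕ.+-suc a n))) (w≗ (suc n)))
                 (λ n a<n n< → free n (ℕ.<⇒≤ a<n) (ℕ.<-≤-trans n< (ℕ.≤-reflexive (≡.sym (ℕ.+-suc a (length u)))))))
      (≡.cong (T u) (≡.trans
        (run-step (free a ℕ.≤-refl (ℕ.m<m+n a (s≤s z≤n))))
        (≡.cong (λ y → ⟦ U y ⟧ (run a)) (≡.trans (≡.cong w (≡.sym (ℕ.+-identityʳ a))) (w≗ 0))))))

    run-at-0 : ∀ u {v} → at c 0 ≡ length u → w ≗ u ++ω v → run (at c 0) ≡ T u s₀
    run-at-0 u c₀≡ w≗ = ≡.trans (≡.cong run c₀≡) (run-free u 0 w≗
      λ { n _ n<u (i , ≡.refl) → ℕ.<⇒≱ n<u (≡.subst (ℕ._≤ at c i) c₀≡ (at-mono c z≤n)) })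

    -- The first letter acts on ψ by the reset at the i-th checkpoint. The others act freely,
    -- because a checkpoint strictly between would have an index strictly between i and i + 1.
    run-at-suc : ∀ i u {v} → 1 ℕ.≤ length u → at c (suc i) ≡ at c i ℕ.+ length u →
                 dropω (at c i) w ≗ u ++ω v → run (at c (suc i)) ≡ T u ψ
    run-at-suc i (x ∷ u) 1≤u cᵢ₊₁≡ w≗ = ≡.trans (≡.cong run end≡)
      (≡.trans (run-free u (suc a)
                 (λ n → ≡.trans (≡.cong w (≡.sym (ℕ.+-suc a n))) (w≗ (suc n)))
                 λ { n a<n n< (j , ≡.refl) → ℕ.<⇒≱
                     (at-cancel-< c (≡.subst (at c j ℕ.<_) (≡.sym end≡) n<))
                     (at-cancel-< c a<n) })
      (≡.cong (T u) (≡.trans (run-reset (i , ≡.refl))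
        (≡.cong (λ y → ⟦ U y ⟧ ψ) (≡.trans (≡.cong w (≡.sym (ℕ.+-identityʳ a))) (w≗ 0))))))
      where
      a = at c i
      end≡ : at c (suc i) ≡ suc a ℕ.+ length u
      end≡ = ≡.trans cᵢ₊₁≡ (ℕ.+-suc a (length u))

-- Acceptance for a fixed ψ as a property of segmentations

module Acceptance (em : ExcludedMiddle 0ℓ) (ℝ : CompleteOrderedField) {A : Set}
                  (𝒜 : QuantumAutomata.QuantumAutomaton em ℝ A)
                  (ψ : QuantumAutomata.QuantumAutomaton.Carrierᴹ 𝒜)
                  (ψ-unit : QuantumAutomata.QuantumAutomaton.IsUnit 𝒜 ψ) where
  open CompleteOrderedField ℝ renaming (zero to *-zero)
  open OrderedField em ℝ
  open QuantumAutomata em ℝ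
  open QuantumAutomaton 𝒜 using (H; Carrierᴹ; s₀; s₀-unit; ⟨_∣_⟩)
  open Evolution em ℝ 𝒜
  open HilbertProperties em ℝ H
  open UnitVector ψ ψ-unit
  open Runs em ℝ 𝒜
  open Checkpoints

  Passes : Carrier → Carrierᴹ → Pred (List A) 0ℓ
  Passes δ s p = δ ≤ fidelity (T p s)

  -- One δ bounds all segments from below: values that merely exceed λ₀ one by one could have
  -- infimum λ₀. The initial p may be empty, since the first checkpoint may be 0.
  Accepted : Carrier → Pred (A ^ω) 0ℓ
  Accepted δ w = ∃ λ p → ∃ λ v → w ≗ p ++ω v × Passes δ s₀ p × Segmented (Passes δ ψ) v

  value : A ^ω → Checkpoints → ℕ → Carrier
  value w c i = ∣ ⟨ ψ ∣ disturbingRun 𝒜 w ψ c (at c i) ⟩ ∣²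

  checkpoints⇒Accepted : ∀ {δ} w c → (∀ i → δ ≤ value w c i) → Accepted δ w
  checkpoints⇒Accepted {δ} w c δ≤ = p , dropω (at c 0) w , w≗
    , passes 0 (run-at-0 w ψ c p (≡.sym (length-applyUpTo w (at c 0))) w≗)
    , record
    { segment  = segment
    ; rest     = λ i → dropω (at c i) w
    ; begins   = λ _ → ≡.refl
    ; unfold   = unfold
    ; nonempty = nonempty
    ; holds    = λ i → passes (suc i) (run-at-suc w ψ c i (segment i) (nonempty i)
                   (≡.trans (≡.sym (gap i)) (≡.cong (at c i ℕ.+_) (≡.sym (length-segment i)))) (unfold i))
    }
    where
    p = applyUpTo w (at c 0)
    w≗ = applyUpTo-++ω (at c 0) w
    passes : ∀ i {s} → disturbingRun 𝒜 w ψ c (at c i) ≡ s → δ ≤ fidelity s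
    passes i ≡.refl = ≤-respʳ-≈ (sym (fidelity≈∣∣² _)) (δ≤ i)
    g : ℕ → ℕ
    g i = at c (suc i) ℕ.∸ at c i
    gap : ∀ i → at c i ℕ.+ g i ≡ at c (suc i)
    gap i = ℕ.m+[n∸m]≡n (at-mono c (ℕ.n≤1+n i))
    segment : ℕ → List A
    segment i = applyUpTo (dropω (at c i) w) (g i)
    length-segment : ∀ i → length (segment i) ≡ g i
    length-segment i = length-applyUpTo (dropω (at c i) w) (g i)
    nonempty : ∀ i → 1 ℕ.≤ length (segment i)
    nonempty i = ≡.subst (1 ℕ.≤_) (≡.sym (length-segment i)) (ℕ.m<n⇒0<n∸m (increasing c (ℕ.n<1+n i)))
    unfold : ∀ i → dropω (at c i) w ≗ segment i ++ω dropω (at c (suc i)) w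
    unfold i n = ≡.trans (applyUpTo-++ω (g i) (dropω (at c i) w) n)
      (++ω-cong (segment i) (λ m → ≡.cong w (≡.trans (≡.sym (ℕ.+-assoc (at c i) (g i) m)) (≡.cong (ℕ._+ m) (gap i)))) n)

  Accepted⇒checkpoints : ∀ {δ} w → Accepted δ w → ∃ λ c → ∀ i → δ ≤ value w c i
  Accepted⇒checkpoints {δ} w (p , v , w≗ , p-passes , S) = c , λ
    { zero    → passes 0 p (run-at-0 w ψ c p ≡.refl w≗) p-passes
    ; (suc i) → passes (suc i) (segment i)
        (run-at-suc w ψ c i (segment i) (nonempty i) ≡.refl (λ n → ≡.trans (position i n) (unfold i n)))
        (holds i)
    }
    where
    open Segmented S
    c-at : ℕ → ℕ
    c-at zero    = length p
    c-at (suc i) = c-at i ℕ.+ length (segment i)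
    c-increasing : ∀ {i j} → i ℕ.<′ j → c-at i ℕ.< c-at j
    c-increasing {i} (ℕ.≤′-reflexive ≡.refl) = ℕ.m<m+n (c-at i) (nonempty i)
    c-increasing {i} {suc j} (ℕ.≤′-step i<j) = ℕ.<-≤-trans (c-increasing i<j) (ℕ.m≤m+n (c-at j) _)
    c : Checkpoints
    c = record { at = c-at ; increasing = λ i<j → c-increasing (ℕ.≤⇒≤′ i<j) }
    position : ∀ i → dropω (c-at i) w ≗ rest i
    position zero    n = ≡.trans (w≗ (length p ℕ.+ n)) (≡.trans (++ω-drop p v n) (begins n))
    position (suc i) n = ≡.trans (≡.cong w (ℕ.+-assoc (c-at i) (length (segment i)) n))
      (≡.trans (position i (length (segment i) ℕ.+ n))
      (≡.trans (unfold i (length (segment i) ℕ.+ n)) (++ω-drop (segment i) (rest (suc i)) n)))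
    passes : ∀ i u {s} → disturbingRun 𝒜 w ψ c (at c i) ≡ T u s → δ ≤ fidelity (T u s) → δ ≤ value w c i
    passes i u run≡ δ≤ = ≤-respʳ-≈ (fidelity≈∣∣² _) (≡.subst (λ s → δ ≤ fidelity s) (≡.sym run≡) δ≤)

  value-nonNeg : ∀ w c i → 0# ≤ value w c i
  value-nonNeg w c i = +-nonNeg (x²-nonNeg _) (x²-nonNeg _)

  -- Index 0 alone already bounds the infimum over the checkpoints by 1, and this bound makes the
  -- suprema exist.
  value≤1 : ∀ w c → value w c 0 ≤ 1#
  value≤1 w c = begin
    value w c 0
      ≡⟨ ≡.cong (λ s → ∣ ⟨ ψ ∣ s ⟩ ∣²)
          (run-at-0 w ψ c p (≡.sym (length-applyUpTo w (at c 0))) (applyUpTo-++ω (at c 0) w)) ⟩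
    ∣ ⟨ ψ ∣ T p s₀ ⟩ ∣²                            ≈⟨ fidelity≈∣∣² (T p s₀) ⟨
    fidelity (T p s₀)                              ≤⟨ bessel (T p s₀) ⟩
    ⟪ T p s₀ , T p s₀ ⟫                            ≈⟨ proj₁ (T-unit p s₀-unit) ⟩
    1#                                             ∎
    where p = applyUpTo w (at c 0)

  Accepted-split : ∀ {δ} n w → Accepted δ w → ∃ λ p → ∃ λ xs → ∃ λ v →
    n ℕ.≤ length (p ++ concat xs) × w ≗ (p ++ concat xs) ++ω v × Passes δ s₀ p ×
    All (λ q → 1 ℕ.≤ length q × Passes δ ψ q) xs × Segmented (Passes δ ψ) v
  Accepted-split n w (p , v , w≗ , p-passes , S) =
    let xs , v′ , n≤xs , v≗ , all , S′ = Segmented-split n S in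
    p , xs , v′
    , ℕ.≤-trans n≤xs (ℕ.≤-trans (ℕ.m≤n+m _ (length p)) (ℕ.≤-reflexive (≡.sym (length-++ p))))
    , (λ m → ≡.trans (w≗ m) (≡.trans (++ω-cong p v≗ m) (≡.sym (++ω-assoc p (concat xs) v′ m))))
    , p-passes , all , S′

  Accepted-concat : ∀ {δ} p {xs v} → Passes δ s₀ p → All (λ q → 1 ℕ.≤ length q × Passes δ ψ q) xs →
    Segmented (Passes δ ψ) v → Accepted δ ((p ++ concat xs) ++ω v)
  Accepted-concat p {xs} {v} p-passes all S =
    p , concat xs ++ω v , ++ω-assoc p (concat xs) v , p-passes , Segmented-concat all S

  module _ {t : Carrier} (0<t : 0# < t) (w : List A) (N : ℕ) where

    private
      lower : Carrier → Carrier
      lower δ = δ - (t + t)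

      lower≤ : ∀ {δ} → lower δ ≤ δ
      lower≤ {δ} = 0≤y-x⇒x≤y (begin
        0#               ≤⟨ +-nonNeg (proj₁ 0<t) (proj₁ 0<t) ⟩
        t + t            ≈⟨ solve 2 (λ δ t → t :+ t := δ :- (δ :- (t :+ t))) refl δ t ⟩
        δ - lower δ      ∎)

      regroup : ∀ u k p {v v′ : A ^ω} → v ≗ p ++ω v′ →
                u ++ω ((w ^ k) ++ω v) ≗ (u ++ (w ^ k) ++ p) ++ω v′
      regroup u k p {v} {v′} v≗ n = ≡.trans
        (++ω-cong u (λ m → ≡.trans (++ω-cong (w ^ k) v≗ m) (≡.sym (++ω-assoc (w ^ k) p v′ m))) n)
        (≡.sym (++ω-assoc u (w ^ k ++ p) v′ n))

      longer : ∀ u k p → length (u ++ p) ℕ.≤ length (u ++ (w ^ k) ++ p)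
      longer u k p = ≡.subst₂ ℕ._≤_ (≡.sym (length-++ u)) (≡.sym (length-++ u))
        (ℕ.+-monoʳ-≤ (length u) (ℕ.≤-trans (ℕ.m≤n+m _ (length (w ^ k))) (ℕ.≤-reflexive (≡.sym (length-++ (w ^ k))))))

    -- Segments are passed over until the one in which u ends. That one receives `w ^ k`, and the
    -- rest only have their threshold weakened. The bound n on the length of u decreases because
    -- segments are nonempty.
    Segmented-pump : ∀ {δ} n u {v} → length u ℕ.≤ n → Segmented (Passes δ ψ) (u ++ω v) →
      ∃ λ k → N ℕ.< k × Segmented (Passes (δ - (t + t)) ψ) (u ++ω ((w ^ k) ++ω v))
    Segmented-pump n u ℓ≤n S with Segmented-uncons S
    ... | p , v′ , uv≗pv′ , 1≤p , p-passes , S′ with ++ω-compare u p uv≗pv′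
    ...   | inj₁ (p′ , ≡.refl , v≗) =
      let k , N<k , passes = fidelity-pump ψ ψ-unit ψ-unit u w p′ 0<t p-passes N in
      k , N<k , Segmented-cons (u ++ w ^ k ++ p′) (regroup u k p′ v≗)
        (ℕ.≤-trans 1≤p (longer u k p′)) passes (Segmented-map (≤-trans lower≤) S′)
    -- Here u extends a nonempty segment, so its length cannot be bounded by 0.
    Segmented-pump zero u ℓ≤n S | p , v′ , uv≗pv′ , 1≤p , p-passes , S′ | inj₂ (u′ , ≡.refl , v′≗) =
      ⊥-elim (ℕ.<⇒≱ (ℕ.≤-trans 1≤p (ℕ.≤-trans (ℕ.m≤m+n _ _) (ℕ.≤-reflexive (≡.sym (length-++ p))))) ℓ≤n)
    Segmented-pump (suc n) u {v} ℓ≤n S | p , v′ , uv≗pv′ , 1≤p , p-passes , S′ | inj₂ (u′ , ≡.refl , v′≗) =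
      let k , N<k , S″ = Segmented-pump n u′ (ℕ.s≤s⁻¹ (ℕ.≤-trans (ℕ.+-monoˡ-≤ (length u′) 1≤p)
                           (ℕ.≤-trans (ℕ.≤-reflexive (≡.sym (length-++ p))) ℓ≤n)))
                           (Segmented-resp (λ m → ≡.sym (v′≗ m)) S′)
      in k , N<k , Segmented-cons p (++ω-assoc p u′ ((w ^ k) ++ω v)) 1≤p (≤-trans lower≤ p-passes) S″

    -- The initial segment is treated apart because it acts on `s₀` and may be empty. If u reaches
    -- beyond it, the insertion happens among the segments acting on ψ.
    Accepted-pump : ∀ {δ} u {v} → Accepted δ (u ++ω v) →
      ∃ λ k → N ℕ.< k × Accepted (δ - (t + t)) (u ++ω ((w ^ k) ++ω v))
    Accepted-pump u {v} (p , v′ , uv≗pv′ , p-passes , S) with ++ω-compare u p uv≗pv′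
    ... | inj₁ (p′ , ≡.refl , v≗) =
      let k , N<k , passes = fidelity-pump ψ ψ-unit s₀-unit u w p′ 0<t p-passes N in
      k , N<k , u ++ w ^ k ++ p′ , v′ , regroup u k p′ v≗ , passes , Segmented-map (≤-trans lower≤) S
    ... | inj₂ (u′ , ≡.refl , v′≗) =
      let k , N<k , S′ = Segmented-pump (length u′) u′ ℕ.≤-refl (Segmented-resp (λ m → ≡.sym (v′≗ m)) S) in
      k , N<k , p , u′ ++ω ((w ^ k) ++ω v) , ++ω-assoc p u′ ((w ^ k) ++ω v) , ≤-trans lower≤ p-passes , S′

  -- Pumping the empty word from ψ, where the fidelity is 1, gives a power of w that nearly fixes ψ.
  -- Every period then starts from ψ again, and k > 0 keeps it nonempty.
  Segmented-repeat : ∀ {t} → 0# < t → ∀ w → Segmented (Passes (1# - (t + t)) ψ) (repeat w)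
  Segmented-repeat {t} 0<t w =
    let k , 0<k , passes = fidelity-pump ψ ψ-unit ψ-unit [] (toList w) [] 0<t (≤-reflexive (sym fidelity-ψ)) 0 in
    Segmented-periodic (toList w ^ k) (repeat-unfold-^ w k) (ℕ.≤-trans 0<k (length-^ w k))
      (≡.subst (Passes (1# - (t + t)) ψ) (++-identityʳ (toList w ^ k)) passes)

  -- The prefix is cut at a checkpoint, from which the tail continues with ψ. The cut is independent
  -- of w; only the length of the periods in the tail varies with w. Splitting at `suc N` makes the
  -- prefix longer than N.
  Accepted-repeat : ∀ {δ t η} → 0# < t → η ≤ δ → η ≤ 1# - (t + t) → ∀ v → Accepted δ v →
    InfinitelyMany (λ n → ∀ w → Accepted η (applyUpTo v n ++ω repeat w))
  Accepted-repeat {η = η} 0<t η≤δ η≤1-2t v acc N with Accepted-split (suc N) v acc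
  ... | p , xs , v′ , N<x , v≗ , p-passes , all , _ = length (p ++ concat xs) , N<x , λ w →
    ≡.subst (λ x → Accepted η (x ++ω repeat w)) (≡.sym (applyUpTo-prefix (p ++ concat xs) v≗))
      (Accepted-concat p (≤-trans η≤δ p-passes)
        (All.map (λ (1≤q , q-passes) → 1≤q , ≤-trans η≤δ q-passes) all)
        (Segmented-map (≤-trans η≤1-2t) (Segmented-repeat 0<t w)))

  -- y is a whole segment, so k copies of it are k segments that pass as y does, and k = 0 deletes
  -- it. Nothing is approximated, and δ is kept.
  Accepted-pump-segment : ∀ {δ} n w → Accepted δ w →
    ∃ λ x → ∃ λ y → ∃ λ z → w ≗ x ++ω (y ++ω z) × n ℕ.≤ length x × 1 ℕ.≤ length y ×
      (∀ k → Accepted δ (x ++ω ((y ^ k) ++ω z)))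
  Accepted-pump-segment n w acc =
    let p , xs , v , n≤x , w≗ , p-passes , all , S = Accepted-split n w acc
        y , z , v≗ , 1≤y , y-passes , S′ = Segmented-uncons S
    in p ++ concat xs , y , z , (λ m → ≡.trans (w≗ m) (++ω-cong (p ++ concat xs) v≗ m)) , n≤x , 1≤y
     , λ k → Accepted-concat p p-passes all (Segmented-concat (replicate⁺ {x = y} k (1≤y , y-passes)) S′)

open import Data.Nat.Base using (_≤_)

-- From acceptance to the language

module Language (em : ExcludedMiddle 0ℓ) (ℝ : CompleteOrderedField) {A : Set}
                (𝒜 : QuantumAutomata.QuantumAutomaton em ℝ A)
                (λ₀ : CompleteOrderedField.Carrier ℝ)
                (0≤λ₀ : CompleteOrderedField._≤_ ℝ (CompleteOrderedField.0# ℝ) λ₀) where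
  private module ℝ = CompleteOrderedField ℝ
  open OrderedField em ℝ using (<-≤-trans; ≤-trans; between; total; ≤-refl; 0<1)
  open SupremaProperties em ℝ
  open QuantumAutomata em ℝ
  open Acceptance em ℝ 𝒜 using (Accepted; value; value-nonNeg; value≤1; checkpoints⇒Accepted; Accepted⇒checkpoints)

  L : A ^ω → Set
  L = 𝓛ᴰ> λ₀ 𝒜

  -- A strict inequality below a supremum is already attained by a member of the family, so the two
  -- suprema yield ψ and the checkpoints. The infimum for these serves as δ.
  ∈L⇒Accepted : ∀ {w} → w ∈ L →
    ∃ λ ((ψ , _ , ψ-unit) : UnitVectorInF 𝒜) → ∃ λ δ → λ₀ ℝ.< δ × Accepted ψ ψ-unit δ w
  ∈L⇒Accepted {w} w∈L =
    let ψ̂@(ψ , _ , ψ-unit) , λ₀<⨆ =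
          <⨆⇒∃< (λ ((ψ , _ , ψ-unit) : UnitVectorInF 𝒜) → ⨆ λ c → ⨅ (value ψ ψ-unit w c)) 0≤λ₀ w∈L
        c , λ₀<⨅ = <⨆⇒∃< (λ c → ⨅ (value ψ ψ-unit w c)) 0≤λ₀ λ₀<⨆
    in ψ̂ , ⨅ (value ψ ψ-unit w c) , λ₀<⨅
     , checkpoints⇒Accepted ψ ψ-unit w c (⨅≤f (value ψ ψ-unit w c) (value-nonNeg ψ ψ-unit w c))

  Accepted⇒∈L : ∀ {w} ((ψ , _ , ψ-unit) : UnitVectorInF 𝒜) {δ} → λ₀ ℝ.< δ → Accepted ψ ψ-unit δ w → w ∈ L
  Accepted⇒∈L {w} ψ̂@(ψ , _ , ψ-unit) {δ} λ₀<δ acc =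
    let c , δ≤ = Accepted⇒checkpoints ψ ψ-unit w acc in
    <-≤-trans λ₀<δ
      (≤-trans (b≤⨅ (value ψ ψ-unit w c) 0 δ≤)
      (≤-trans (f≤⨆ (λ c → ⨅ (value ψ ψ-unit w c)) ℝ.1# (⨅≤1 ψ̂) c)
               (f≤⨆ (λ ((ψ , _ , ψ-unit) : UnitVectorInF 𝒜) → ⨆ λ c → ⨅ (value ψ ψ-unit w c)) ℝ.1#
                 (λ φ̂@(φ , _ , φ-unit) → ⨆-≤ (λ c → ⨅ (value φ φ-unit w c)) (proj₁ 0<1) (⨅≤1 φ̂)) ψ̂)))
    where
    ⨅≤1 : ∀ ((φ , _ , φ-unit) : UnitVectorInF 𝒜) c → ⨅ (value φ φ-unit w c) ℝ.≤ ℝ.1#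
    ⨅≤1 (φ , _ , φ-unit) c =
      ≤-trans (⨅≤f (value φ φ-unit w c) (value-nonNeg φ φ-unit w c) 0) (value≤1 φ φ-unit w c)

  pump-middle : ∀ (w : List⁺ A) u v → u ++ω v ∈ L →
    InfinitelyMany (λ k → 1 ≤ k × u ++ω ((toList w ^ k) ++ω v) ∈ L)
  pump-middle w u v uv∈L N =
    let ψ̂@(ψ , _ , ψ-unit) , δ , λ₀<δ , acc = ∈L⇒Accepted uv∈L
        t , 0<t , λ₀<δ-2t = between λ₀<δ
        k , N<k , acc′ = Acceptance.Accepted-pump em ℝ 𝒜 ψ ψ-unit 0<t (toList w) N u acc
    in k , N<k , ℕ.≤-trans (ℕ.s≤s ℕ.z≤n) N<k , Accepted⇒∈L ψ̂ λ₀<δ-2t acc′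

  repeat-tail : λ₀ ℝ.< ℝ.1# → ∀ v → v ∈ L →
    InfinitelyMany (λ n → (w : List⁺ A) → applyUpTo v n ++ω repeat w ∈ L)
  repeat-tail λ₀<1 v v∈L N =
    let ψ̂@(ψ , _ , ψ-unit) , δ , λ₀<δ , acc = ∈L⇒Accepted v∈L
        -- The gap used is the one below 1, since the periods of the tail start from ψ with fidelity
        -- 1 and not δ. The prefix keeps δ, and η is the smaller of the two thresholds.
        t , 0<t , λ₀<1-2t = between λ₀<1
        η , λ₀<η , η≤δ , η≤1-2t = common λ₀<δ λ₀<1-2t
        n , N<n , acc′ = Acceptance.Accepted-repeat em ℝ 𝒜 ψ ψ-unit 0<t η≤δ η≤1-2t v acc N
    in n , N<n , λ w → Accepted⇒∈L ψ̂ λ₀<η (acc′ w)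
    where
    common : ∀ {a b} → λ₀ ℝ.< a → λ₀ ℝ.< b → ∃ λ η → λ₀ ℝ.< η × η ℝ.≤ a × η ℝ.≤ b
    common {a} {b} λ₀<a λ₀<b with total a b
    ... | inj₁ a≤b = a , λ₀<a , ≤-refl , a≤b
    ... | inj₂ b≤a = b , λ₀<b , b≤a , ≤-refl

  pump-segment : ∀ n w → w ∈ L → ∃ λ (x : List A) → ∃ λ (y : List A) → ∃ λ (z : A ^ω) →
    (w ≗ x ++ω (y ++ω z)) × (n ≤ length x) × (1 ≤ length y) × ((k : ℕ) → x ++ω ((y ^ k) ++ω z) ∈ L)
  pump-segment n w w∈L =
    let ψ̂@(ψ , _ , ψ-unit) , δ , λ₀<δ , acc = ∈L⇒Accepted w∈L
        x , y , z , w≗ , n≤x , 1≤y , acc′ = Acceptance.Accepted-pump-segment em ℝ 𝒜 ψ ψ-unit n w acc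
    in x , y , z , w≗ , n≤x , 1≤y , λ k → Accepted⇒∈L ψ̂ λ₀<δ (acc′ k)

theorem4 :
    (em : ExcludedMiddle 0ℓ) (ℝ : CompleteOrderedField) →
    let module ℝ = CompleteOrderedField ℝ
        open QuantumAutomata em ℝ
    in
    (A : Set) → Finite A →
    (λ₀ : ℝ.Carrier) → ℝ.0# ℝ.≤ λ₀ → λ₀ ℝ.< ℝ.1# →
    (𝒜 : QuantumAutomaton A) →
    let L = 𝓛ᴰ> λ₀ 𝒜 in
    ((w : List⁺ A) (u : List A) (v : A ^ω) → u ++ω v ∈ L →
      InfinitelyMany (λ k → 1 ≤ k × u ++ω ((toList w ^ k) ++ω v) ∈ L))
    ×
    ((v : A ^ω) → v ∈ L →
      InfinitelyMany (λ n → (w : List⁺ A) → applyUpTo v n ++ω repeat w ∈ L))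
    ×
    ((n : ℕ) → 1 ≤ n → (w : A ^ω) → w ∈ L →
      ∃ λ (x : List A) → ∃ λ (y : List A) → ∃ λ (z : A ^ω) →
        (w ≗ x ++ω (y ++ω z)) × (n ≤ length x) × (1 ≤ length y) ×
        ((k : ℕ) → x ++ω ((y ^ k) ++ω z) ∈ L))
theorem4 em ℝ A _ λ₀ 0≤λ₀ λ₀<1 𝒜 =
  pump-middle , repeat-tail λ₀<1 , λ n _ w → pump-segment n w
  where open Language em ℝ 𝒜 λ₀ 0≤λ₀
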